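{- There is a deterministic two-pass streaming algorithm that, given a graph stream of a connected weighted graph $G$ on $n$ vertices, uses $\tilde O(n)$ space and outputs a value $X$ with $\mathsf{TSP}(G)\le X\le 1.96\cdot\mathsf{TSP}(G)$.
   Context: A graph stream of a weighted graph $G$ is a stream of its edges with their weights, in arbitrary order (the same in both passes). $\mathsf{TSP}(G)$ denotes the minimum weight of a Hamiltonian cycle in the shortest-path metric induced by $G$. $\tilde O$ hides polylogarithmic factors in $n$.
   Formalization: The edge weights of the graph are nonnegative rational numbers rather than reals; space is counted in machine words of b + O(log n) bits kept between stream items, where b bounds the bit size of the weights. -}

module Defs where

open import Data.Bool using (Bool)
open import Data.Fin using (Fin)
open import Data.Integer using (∣_∣)
open import Data.List using (List; []; _∷_; allFin; foldl)
open import Data.List.Membership.Propositional using (_∈_)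
open import Data.List.Relation.Binary.Permutation.Propositional using (_↭_)
open import Data.List.Relation.Unary.AllPairs using (AllPairs)
open import Data.Maybe using (Maybe; just; nothing)
open import Data.Nat as ℕ using (ℕ; suc)
open import Data.Nat.Logarithm using (⌊log₂_⌋)
open import Data.Product using (Σ-syntax; ∃-syntax; _×_; _,_)
open import Data.Rational using (ℚ; 0ℚ; _+_; _≤_; ↥_; ↧ₙ_)
open import Data.Sum using (_⊎_)
open import Data.Vec using (Vec)
open import Relation.Binary.PropositionalEquality using (_≡_)
open import Relation.Nullary using (¬_)

-- A finite simple undirected graph on the vertices Fin n; weight u v ≡ just w
-- means that uv is an edge of weight w, and nothing that uv is not an edge.
record WeightedGraph (n : ℕ) : Set where
  field
    weight        : Fin n → Fin n → Maybe ℚ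
    weight-sym    : ∀ u v → weight u v ≡ weight v u
    loopless      : ∀ u → weight u u ≡ nothing
    weight-nonNeg : ∀ u v w → weight u v ≡ just w → 0ℚ ≤ w

open WeightedGraph public

data Path {n : ℕ} (G : WeightedGraph n) : Fin n → Fin n → Set where
  stop : ∀ {u} → Path G u u
  step : ∀ {u v x} (w : ℚ) → weight G u v ≡ just w → Path G v x → Path G u x

pathLength : ∀ {n} {G : WeightedGraph n} {u v} → Path G u v → ℚ
pathLength stop         = 0ℚ
pathLength (step w _ p) = w + pathLength p

Connected : ∀ {n} → WeightedGraph n → Set
Connected {n} G = ℕ.NonZero n × (∀ u v → Path G u v)

IsMinimumOf : {A : Set} → (A → ℚ) → ℚ → Set
IsMinimumOf {A} f m = (∃[ a ] f a ≡ m) × (∀ (a : A) → m ≤ f a)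

IsShortestPathMetric : ∀ {n} → WeightedGraph n → (Fin n → Fin n → ℚ) → Set
IsShortestPathMetric G d = ∀ u v → IsMinimumOf (pathLength {G = G} {u} {v}) (d u v)

-- A Hamiltonian cycle of the complete graph on Fin n, as the list of all
-- vertices in the order of traversal; the edge from the last vertex back to
-- the first is implicit.  For n = 1 its weight is d v v, and for n = 2 the
-- single edge is traversed back and forth.
HamiltonianCycle : ℕ → Set
HamiltonianCycle n = Σ[ vs ∈ List (Fin n) ] vs ↭ allFin n

module _ {n : ℕ} (d : Fin n → Fin n → ℚ) where

  -- The weight of the walk that starts in u, visits the list in order and
  -- ends in r.
  walkWeight : Fin n → List (Fin n) → Fin n → ℚ
  walkWeight u []       r = d u r
  walkWeight u (v ∷ vs) r = d u v + walkWeight v vs r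

  closedWalkWeight : List (Fin n) → ℚ
  closedWalkWeight []       = 0ℚ
  closedWalkWeight (v ∷ vs) = walkWeight v vs v

  cycleWeight : HamiltonianCycle n → ℚ
  cycleWeight (vs , _) = closedWalkWeight vs

-- IsTSP G t says TSP(G) = t.
IsTSP : ∀ {n} → WeightedGraph n → ℚ → Set
IsTSP {n} G t =
  Σ[ d ∈ (Fin n → Fin n → ℚ) ] IsShortestPathMetric G d × IsMinimumOf (cycleWeight d) t

StreamItem : ℕ → Set
StreamItem n = Fin n × Fin n × ℚ

SameEdge : ∀ {n} → StreamItem n → StreamItem n → Set
SameEdge (u , v , _) (x , y , _) = (u ≡ x × v ≡ y) ⊎ (u ≡ y × v ≡ x)

-- Every edge of G occurs exactly once, in one of its two orientations, with
-- its weight; the order is arbitrary.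
record IsGraphStream {n : ℕ} (G : WeightedGraph n) (s : List (StreamItem n)) : Set where
  field
    sound    : ∀ {u v w} → (u , v , w) ∈ s → weight G u v ≡ just w
    complete : ∀ {u v w} → weight G u v ≡ just w → (u , v , w) ∈ s ⊎ (v , u , w) ∈ s
    distinct : AllPairs (λ e f → ¬ SameEdge e f) s

-- Numerator and denominator, in lowest terms, are b-bit numbers.
HasBitSize : ℕ → ℚ → Set
HasBitSize b w = ∣ ↥ w ∣ ℕ.< 2 ℕ.^ b × ↧ₙ w ℕ.< 2 ℕ.^ b

WeightsHaveBitSize : ∀ {n} → ℕ → WeightedGraph n → Set
WeightsHaveBitSize b G = ∀ u v w → weight G u v ≡ just w → HasBitSize b w

-- The number of binary digits of n for n ≥ 1; it is Θ(log n), and positive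
-- also for n = 1.
bitLength : ℕ → ℕ
bitLength n = suc ⌊log₂ n ⌋

-- On n-vertex graphs with b-bit weights a machine word has b + O(log n) bits,
-- so that vertices and weights take O(1) words each.
Memory : (n b words : ℕ) → Set
Memory n b words = Vec (Vec Bool (b ℕ.+ bitLength n)) words

-- What is bounded is the memory carried from one stream item to the next (and
-- from the first pass to the second); an algorithm knows n and b in advance.
record TwoPassAlgorithm : Set where
  field
    space   : (n b : ℕ) → ℕ
    start   : ∀ n b → Memory n b (space n b)
    pass₁   : ∀ n b → Memory n b (space n b) → StreamItem n → Memory n b (space n b)
    between : ∀ n b → Memory n b (space n b) → Memory n b (space n b)
    pass₂   : ∀ n b → Memory n b (space n b) → StreamItem n → Memory n b (space n b)
    output  : ∀ n b → Memory n b (space n b) → ℚ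

  run : ∀ n b → List (StreamItem n) → ℚ
  run n b s =
    output n b (foldl (pass₂ n b) (between n b (foldl (pass₁ n b) (start n b) s)) s)

open TwoPassAlgorithm public

-- Space n · polylog(n), with constants independent of the weight size b.
UsesÕ[n]Space : TwoPassAlgorithm → Set
UsesÕ[n]Space A =
  ∃[ C ] ∃[ k ] (∀ n b → space A n b ℕ.≤ C ℕ.* (n ℕ.* bitLength n ℕ.^ k))

{-# OPTIONS --safe #-}
module Submission where

-- The first pass keeps a minimum spanning tree T.  In the second pass an edge
-- e is called profitable if the tree edges on the tree path of e that are not
-- covered yet weigh at least 3/2 · w(e); then they are marked as covered.  Let
-- E be the set of profitable edges and C the set of covered tree edges, so
-- that w(E) ≤ 2/3 · w(C).  The output is X = 2 w(T) − w(C)/6.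
--
-- TSP ≤ X: a uniformly random subset of E crosses the fundamental cut of each
-- edge of C an odd number of times with probability 1/2.  Hence some J ⊆ E
-- does so for a set P of tree edges with w(P) − w(J) ≥ (w(C) − w(E))/2 ≥
-- w(C)/6.  Doubling the edges of T outside P and adding J gives a connected
-- graph with even degrees of weight 2 w(T) − w(P) + w(J), and an Euler tour of
-- it can be shortcut.
--
-- X ≤ 47/24 · TSP: an optimal tour, expanded into edges of G, crosses every
-- fundamental cut twice, and each of its edges e has at most 3/2 · w(e) of
-- uncovered weight on its tree path.  So 2 (w(T) − w(C)) ≤ 3/2 · TSP, and
-- w(T) ≤ TSP.

open import Data.Bool using (Bool; true; false; if_then_else_; _∧_; _∨_; not; _xor_)
import Data.Bool.Properties as Bool
open import Data.Bool.Solver using (module xor-∧-Solver)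
open import Data.Fin as Fin using (Fin; toℕ; fromℕ<)
open import Data.Fin.Properties using (all?; toℕ<n; fromℕ<-toℕ)
open import Data.Integer using (+_; -[1+_]; ∣_∣)
open import Data.List using (List; []; _∷_; _++_; length; filter; map; concatMap; allFin; deduplicate; foldl; reverse; _ʳ++_)
open import Data.List.Membership.DecPropositional using () renaming (_∈?_ to member?)
open import Data.List.Membership.Propositional using (_∈_; _∉_; find; lose)
open import Data.List.Membership.Propositional.Properties using (∈-filter⁺; ∈-filter⁻; ∈-++⁺ˡ; ∈-++⁺ʳ; ∈-++⁻; ∈-∃++; ∈-allFin; ∈-deduplicate⁺; ∈-map⁺; ∈-concatMap⁺)
open import Data.List.Membership.Propositional.Properties.WithK using (unique∧set⇒bag)
open import Data.List.Properties using (++-assoc; filter-all; filter-reject; length-++; length-tabulate)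
open import Data.List.Relation.Binary.BagAndSetEquality using (∼bag⇒↭)
open import Data.List.Relation.Binary.Permutation.Propositional using (_↭_; ↭-refl; ↭-sym; ↭⇒↭ₛ)
open import Data.List.Relation.Binary.Permutation.Propositional.Properties using (∈-resp-↭; ↭-length)
import Data.List.Relation.Binary.Permutation.Setoid.Properties as Permutationₛ
open import Data.List.Relation.Binary.Sublist.Propositional using (_⊆_; []; _∷_; _∷ʳ_; ⊆-trans)
open import Data.List.Relation.Binary.Sublist.Propositional.Properties using (filter-⊆)
open import Data.List.Relation.Unary.All as All using (All; []; _∷_)
import Data.List.Relation.Unary.All.Properties as All
open import Data.List.Relation.Unary.AllPairs using (AllPairs; []; _∷_)
open import Data.List.Relation.Unary.Any using (Any; here; there; any?)
open import Data.List.Relation.Unary.Any.Properties using (reverse⁺; reverse⁻)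
import Data.List.Relation.Unary.Unique.DecPropositional as Unique
import Data.List.Relation.Unary.Unique.DecPropositional.Properties as Unique
open import Data.List.Relation.Unary.Unique.Propositional using (Unique)
open import Data.List.Relation.Unary.Unique.Propositional.Properties using (allFin⁺)
open import Data.Maybe using (Maybe; just; nothing)
open import Data.Nat as ℕ using (ℕ; zero; suc; z<s; s<s; _^_; _∸_)
open import Data.Nat.Logarithm using (⌊log₂_⌋; ⌊log₂⌋-mono-≤; ⌊log₂[2^n]⌋≡n)
import Data.Nat.Properties as ℕ
open import Data.Product using (Σ-syntax; ∃-syntax; _×_; _,_; proj₁; proj₂)
open import Data.Rational using (ℚ; mkℚ; ↥_; ↧ₙ_; 0ℚ; 1ℚ; _+_; _-_; _*_; _/_; _≤_; _≤?_; *≤*; nonNegative)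
import Data.Rational.Properties as ℚ
open import Data.Rational.Solver using (module +-*-Solver)
open import Data.Sum using (_⊎_; inj₁; inj₂; [_,_]′)
open import Data.Vec as Vec using (Vec; []; _∷_; replicate)
open import Data.Vec.Relation.Unary.All as VecAll using ([]; _∷_)
open import Function using (_∘_; id)
open import Function.Bundles using (mk⇔)
open import Relation.Binary.PropositionalEquality using (_≡_; _≢_; refl; sym; trans; cong; cong₂; subst; subst₂; setoid; module ≡-Reasoning)
open import Relation.Nullary using (¬_; Dec; yes; no; does; contradiction)
open import Relation.Nullary.Decidable using (map′; dec-true; dec-false; _⊎-dec_; _×-dec_)
open import Defs

-- Tree paths of profitable edges may overlap, so adding all of E could hit a covered tree edge an
-- even number of times and save nothing there. A random subset has no such bias: as soon as one
-- edge of E covers a tree edge, the coin of that edge alone makes the parity uniform. Degrees are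
-- even because P is the mod 2 sum of the tree paths of J, so that P and J together are a sum of
-- cycles. Neither E nor J is ever stored: X depends on T and the marks alone.
--
-- With a threshold r in place of 3/2 the saving is (1 - 1/r)/2 · w(C), the uncovered weight is at
-- most r/2 · TSP, and the ratio becomes 2 - (1 - 1/r)(1 - r/2)/2. The best choice is r = √2; 3/2 is
-- a rational nearby and gives 47/24.
--
-- Tree paths are never constructed. The path of an edge is the set of tree edges whose fundamental
-- cuts separate its ends, so that paths, boundaries and degree parities become linear algebra over
-- 𝔽₂.

private variable n : ℕ

src tgt : StreamItem n → Fin n
src (u , _ , _) = u
tgt (_ , v , _) = v

wt : StreamItem n → ℚ
wt (_ , _ , w) = w

total : List (StreamItem n) → ℚ
total []      = 0ℚ
total (e ∷ L) = wt e + total L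

length-Unique-⊆ : {A : Set} {xs ys : List A} → Unique xs → (∀ {x} → x ∈ xs → x ∈ ys) → length xs ℕ.≤ length ys
length-Unique-⊆ [] _ = ℕ.z≤n
length-Unique-⊆ {xs = x ∷ xs} (x∉ ∷ uniq) sub with ∈-∃++ (sub (here refl))
... | as , bs , refl = begin
  suc (length xs)               ≤⟨ ℕ.s≤s (length-Unique-⊆ uniq sub′) ⟩
  suc (length (as ++ bs))       ≡⟨ cong suc (length-++ as) ⟩
  suc (length as ℕ.+ length bs) ≡⟨ ℕ.+-suc (length as) (length bs) ⟨
  length as ℕ.+ suc (length bs) ≡⟨ length-++ as ⟨
  length (as ++ x ∷ bs)         ∎
  where
  open ℕ.≤-Reasoning
  sub′ : ∀ {y} → y ∈ xs → y ∈ as ++ bs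
  sub′ y∈ with ∈-++⁻ as (sub (there y∈))
  ... | inj₁ y∈as         = ∈-++⁺ˡ y∈as
  ... | inj₂ (there y∈bs) = ∈-++⁺ʳ as y∈bs
  ... | inj₂ (here refl)  = contradiction refl (All.lookup x∉ y∈)

length-Unique : {xs : List (Fin n)} → Unique xs → length xs ℕ.≤ n
length-Unique {n} {xs} uniq =
  subst (length xs ℕ.≤_) (length-tabulate {n = n} id) (length-Unique-⊆ uniq (λ {x} _ → ∈-allFin x))

-- Connected components by labels

relabel : Fin n → Fin n → Fin n → Fin n
relabel a b c with c Fin.≟ b
... | yes _ = a
... | no  _ = c

-- Two vertices are connected by the edges of L iff they have the same label;
-- a new edge replaces the label of its target by that of its source.
comp : List (StreamItem n) → Fin n → Fin n
comp []      x = x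
comp (e ∷ L) x = relabel (comp L (src e)) (comp L (tgt e)) (comp L x)

record Joined {n : ℕ} (L : List (StreamItem n)) (x y : Fin n) : Set where
  constructor joined
  field sameLabel : comp L x ≡ comp L y

open Joined

joined? : (L : List (StreamItem n)) (x y : Fin n) → Dec (Joined L x y)
joined? L x y = map′ joined sameLabel (comp L x Fin.≟ comp L y)

module _ {L : List (StreamItem n)} where

  joined-refl : ∀ {x} → Joined L x x
  joined-refl = joined refl

  joined-sym : ∀ {x y} → Joined L x y → Joined L y x
  joined-sym (joined p) = joined (sym p)

  joined-trans : ∀ {x y z} → Joined L x y → Joined L y z → Joined L x z
  joined-trans (joined p) (joined q) = joined (trans p q)

Spans : List (StreamItem n) → StreamItem n → Set
Spans L e = Joined L (src e) (tgt e)

spans? : (L : List (StreamItem n)) (e : StreamItem n) → Dec (Spans L e)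
spans? L e = joined? L (src e) (tgt e)

joined-∷ : ∀ (e : StreamItem n) {L x y} → Joined L x y → Joined (e ∷ L) x y
joined-∷ e {L} (joined p) = joined (cong (relabel (comp L (src e)) (comp L (tgt e))) p)

spans-here : ∀ (e : StreamItem n) L → Spans (e ∷ L) e
spans-here e L = joined same
  where
  same : comp (e ∷ L) (src e) ≡ comp (e ∷ L) (tgt e)
  same with comp L (src e) Fin.≟ comp L (tgt e) | comp L (tgt e) Fin.≟ comp L (tgt e)
  ... | yes _ | yes _ = refl
  ... | no  _ | yes _ = refl
  ... | _     | no ¬p = contradiction refl ¬p

spans-∈ : ∀ {e : StreamItem n} {L} → e ∈ L → Spans L e
spans-∈ {e = e} {L = _ ∷ L} (here refl) = spans-here e L
spans-∈ {L = f ∷ L}         (there e∈)  = joined-∷ f (spans-∈ e∈)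

joined-∷⁻ : ∀ (e : StreamItem n) L x y → Joined (e ∷ L) x y →
  Joined L x y ⊎ (Joined L x (src e) × Joined L y (tgt e)) ⊎ (Joined L x (tgt e) × Joined L y (src e))
joined-∷⁻ e L x y (joined eq) with comp L x Fin.≟ comp L (tgt e) | comp L y Fin.≟ comp L (tgt e)
... | yes p | yes q = inj₁ (joined (trans p (sym q)))
... | yes p | no  _ = inj₂ (inj₂ (joined p , joined (sym eq)))
... | no  _ | yes q = inj₂ (inj₁ (joined eq , joined q))
... | no  _ | no  _ = inj₁ (joined eq)

-- A label is itself a vertex of the component, so a function that is constant along edges cannot
-- tell a vertex from its label. This is used with `g` a labelling by another edge set, a potential,
-- or a cut.
comp-universal : {A : Set} (g : Fin n → A) (L : List (StreamItem n)) →
  (∀ {e} → e ∈ L → g (src e) ≡ g (tgt e)) → ∀ x → g (comp L x) ≡ g x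
comp-universal g []      _    x = refl
comp-universal g (e ∷ L) edge x with comp L x Fin.≟ comp L (tgt e)
... | no  _ = comp-universal g L (edge ∘ there) x
... | yes p = begin
  g (comp L (src e)) ≡⟨ comp-universal g L (edge ∘ there) (src e) ⟩
  g (src e)          ≡⟨ edge (here refl) ⟩
  g (tgt e)          ≡⟨ comp-universal g L (edge ∘ there) (tgt e) ⟨
  g (comp L (tgt e)) ≡⟨ cong g p ⟨
  g (comp L x)       ≡⟨ comp-universal g L (edge ∘ there) x ⟩
  g x                ∎
  where open ≡-Reasoning

joined-universal : {A : Set} (g : Fin n → A) (L : List (StreamItem n)) →
  (∀ {e} → e ∈ L → g (src e) ≡ g (tgt e)) → ∀ {x y} → Joined L x y → g x ≡ g y
joined-universal g L edge {x} {y} (joined eq) =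
  trans (sym (comp-universal g L edge x)) (trans (cong g eq) (comp-universal g L edge y))

joined-⊆ : ∀ {L K : List (StreamItem n)} → (∀ {e} → e ∈ L → Spans K e) → ∀ {x y} → Joined L x y → Joined K x y
joined-⊆ {L = L} {K} sub p = joined (joined-universal (comp K) L (sameLabel ∘ sub) p)

data Forest {n : ℕ} : List (StreamItem n) → Set where
  []  : Forest []
  _∷_ : ∀ {e L} → ¬ Spans L e → Forest L → Forest (e ∷ L)

-- Every edge of a forest abolishes a label for good.
lostLabels : List (StreamItem n) → List (Fin n)
lostLabels []      = []
lostLabels (e ∷ L) = comp L (tgt e) ∷ lostLabels L

comp∉lostLabels : ∀ {L : List (StreamItem n)} → Forest L → ∀ x → comp L x ∉ lostLabels L
comp∉lostLabels {L = e ∷ L} (¬sp ∷ F) x x∈ with comp L x Fin.≟ comp L (tgt e) | x∈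
... | yes _ | here eq = ¬sp (joined eq)
... | no ¬p | here eq = ¬p eq
... | yes _ | there y = comp∉lostLabels F _ y
... | no  _ | there y = comp∉lostLabels F _ y

lostLabels-Unique : ∀ {L : List (StreamItem n)} → Forest L → Unique (lostLabels L)
lostLabels-Unique             []      = []
lostLabels-Unique {L = e ∷ _} (_ ∷ F) = All.¬Any⇒All¬ _ (comp∉lostLabels F (tgt e)) ∷ lostLabels-Unique F

length-lostLabels : ∀ (L : List (StreamItem n)) → length (lostLabels L) ≡ length L
length-lostLabels []      = refl
length-lostLabels (_ ∷ L) = cong suc (length-lostLabels L)

length-Forest : ∀ {L : List (StreamItem n)} → Forest L → length L ℕ.≤ n
length-Forest {L = L} F = subst (ℕ._≤ _) (length-lostLabels L) (length-Unique (lostLabels-Unique F))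

-- Streaming Kruskal

Descending : List (StreamItem n) → Set
Descending = AllPairs (λ e f → wt f ≤ wt e)

insert : StreamItem n → List (StreamItem n) → List (StreamItem n)
insert e [] = e ∷ []
insert e (f ∷ L) with wt f ≤? wt e
... | yes _ = e ∷ f ∷ L
... | no  _ = f ∷ insert e L

-- On a descending list the recursion decides the lightest edge first, as Kruskal's algorithm does.
kruskal : List (StreamItem n) → List (StreamItem n)
kruskal []      = []
kruskal (e ∷ L) with spans? (kruskal L) e
... | yes _ = kruskal L
... | no  _ = e ∷ kruskal L

∈-insert : ∀ (e : StreamItem n) L {f} → f ∈ e ∷ L → f ∈ insert e L
∈-insert e []      f∈ = f∈
∈-insert e (g ∷ L) f∈ with wt g ≤? wt e | f∈
... | yes _ | f∈                 = f∈
... | no  _ | here p             = there (∈-insert e L (here p))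
... | no  _ | there (here p)     = here p
... | no  _ | there (there f∈L)  = there (∈-insert e L (there f∈L))

∈-insert⁻ : ∀ (e : StreamItem n) L {f} → f ∈ insert e L → f ∈ e ∷ L
∈-insert⁻ e []      f∈ = f∈
∈-insert⁻ e (g ∷ L) f∈ with wt g ≤? wt e | f∈
... | yes _ | f∈       = f∈
... | no  _ | here p   = there (here p)
... | no  _ | there f∈ with ∈-insert⁻ e L f∈
...   | here p    = here p
...   | there f∈L = there (there f∈L)

insert-Descending : ∀ {e : StreamItem n} {L} → Descending L → Descending (insert e L)
insert-Descending [] = [] ∷ []
insert-Descending {e = e} {L = f ∷ L} (f≥ ∷ D) with wt f ≤? wt e
... | yes f≤e = (f≤e ∷ All.map (λ g≤f → ℚ.≤-trans g≤f f≤e) f≥) ∷ f≥ ∷ D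
... | no  f≰e = All.tabulate below ∷ insert-Descending D
  where
  below : ∀ {g} → g ∈ insert e L → wt g ≤ wt f
  below g∈ with ∈-insert⁻ e L g∈
  ... | here refl = ℚ.<⇒≤ (ℚ.≰⇒> f≰e)
  ... | there g∈L = All.lookup f≥ g∈L

∈-kruskal⁻ : ∀ (L : List (StreamItem n)) {f} → f ∈ kruskal L → f ∈ L
∈-kruskal⁻ (e ∷ L) f∈ with spans? (kruskal L) e | f∈
... | yes _ | f∈       = there (∈-kruskal⁻ L f∈)
... | no  _ | here p   = here p
... | no  _ | there f∈ = there (∈-kruskal⁻ L f∈)

kruskal-Descending : ∀ {L : List (StreamItem n)} → Descending L → Descending (kruskal L)
kruskal-Descending [] = []
kruskal-Descending {L = e ∷ L} (e≥ ∷ D) with spans? (kruskal L) e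
... | yes _ = kruskal-Descending D
... | no  _ = All.tabulate (All.lookup e≥ ∘ ∈-kruskal⁻ L) ∷ kruskal-Descending D

kruskal-Forest : ∀ (L : List (StreamItem n)) → Forest (kruskal L)
kruskal-Forest [] = []
kruskal-Forest (e ∷ L) with spans? (kruskal L) e
... | yes _  = kruskal-Forest L
... | no ¬sp = ¬sp ∷ kruskal-Forest L

below : ℚ → List (StreamItem n) → List (StreamItem n)
below w = filter (λ f → wt f ≤? w)

-- The edge e is a heaviest edge of the cycle that it closes with T.
Light : List (StreamItem n) → StreamItem n → Set
Light T e = Spans (below (wt e) T) e

light⇒spans : ∀ {T : List (StreamItem n)} {e} → Light T e → Spans T e
light⇒spans {T = T} = joined-⊆ (λ f∈ → spans-∈ (proj₁ (∈-filter⁻ (λ f → wt f ≤? _) {xs = T} f∈)))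

below-mono : ∀ {w} {T T′ : List (StreamItem n)} → (∀ {f} → f ∈ T → f ∈ T′) →
  ∀ {x y} → Joined (below w T) x y → Joined (below w T′) x y
below-mono {w = w} {T} {T′} sub = joined-⊆ λ f∈ →
  let f∈T , f≤w = ∈-filter⁻ (λ f → wt f ≤? w) {xs = T} f∈ in
  spans-∈ (∈-filter⁺ (λ f → wt f ≤? w) {xs = T′} (sub f∈T) f≤w)

kruskal-Light : ∀ {L : List (StreamItem n)} → Descending L → ∀ {e} → e ∈ L → Light (kruskal L) e
kruskal-Light {L = f ∷ L} (f≥ ∷ D) e∈ with spans? (kruskal L) f | e∈
... | yes _  | there e∈  = kruskal-Light D e∈
... | no _   | there e∈  = below-mono {T = kruskal L} {f ∷ kruskal L} there (kruskal-Light D e∈)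
... | no _   | here refl = spans-∈ (∈-filter⁺ (λ g → wt g ≤? wt f) {xs = f ∷ kruskal L} (here refl) ℚ.≤-refl)
-- `f` was rejected because `kruskal L` connects its ends; all those edges come from `L` and weigh
-- at most `wt f`, so the filter removes none of them.
... | yes sp | here refl =
  subst (λ K → Spans K f) (sym (filter-all (λ g → wt g ≤? wt f) (All.tabulate (All.lookup f≥ ∘ ∈-kruskal⁻ L)))) sp

-- Each edge on the connection for `e` is replaced by edges no heavier than itself. Hence edges may
-- be forgotten for good when the forest is updated.
light-trans : ∀ {T T′ : List (StreamItem n)} → (∀ {f} → f ∈ T → Light T′ f) → ∀ {e} → Light T e → Light T′ e
light-trans {T = T} {T′} light {e} = joined-⊆ λ {f} f∈ →
  let f∈T , f≤e = ∈-filter⁻ (λ f → wt f ≤? wt e) {xs = T} f∈ in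
  joined-⊆ (λ g∈ →
    let g∈T , g≤f = ∈-filter⁻ (λ g → wt g ≤? wt f) {xs = T′} g∈ in
    spans-∈ (∈-filter⁺ (λ g → wt g ≤? wt e) {xs = T′} g∈T (ℚ.≤-trans g≤f f≤e)))
    (light f∈T)

update : List (StreamItem n) → StreamItem n → List (StreamItem n)
update T e = kruskal (insert e T)

-- Minimality is recorded by the cycle criterion `light`, which survives updates by `light-trans`;
-- minimal total weight is derived from it in `msf-minimal`.
record IsMSF {n : ℕ} (seen T : List (StreamItem n)) : Set where
  field
    descending : Descending T
    forest     : Forest T
    subset     : ∀ {e} → e ∈ T → e ∈ seen
    light      : ∀ {e} → e ∈ seen → Light T e

update-IsMSF : ∀ {seen T : List (StreamItem n)} {e} → IsMSF seen T → IsMSF (e ∷ seen) (update T e)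
update-IsMSF {seen = seen} {T} {e} msf = record
  { descending = kruskal-Descending {L = insert e T} desc
  ; forest     = kruskal-Forest (insert e T)
  ; subset     = λ f∈ → sub (∈-insert⁻ e T (∈-kruskal⁻ (insert e T) f∈))
  ; light      = λ { (here refl) → kruskal-Light desc (∈-insert e T (here refl))
                   ; (there f∈)  → light-trans {T′ = update T e}
                       (λ g∈ → kruskal-Light desc (∈-insert e T (there g∈))) (light f∈) }
  }
  where
  open IsMSF msf
  desc : Descending (insert e T)
  desc = insert-Descending descending
  sub : ∀ {f} → f ∈ e ∷ T → f ∈ e ∷ seen
  sub (here p)  = here p
  sub (there p) = there (subset p)

-- Minimality of the spanning forest

-- Matroid exchange. Add the edges of `S` to `R` from the end of the list; `e` is the one that first
-- connects the ends of `f`. Over the edges added earlier, `e` and `f` span each other, and if `R`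
-- spanned `e`, then `f` would have been connected without it.
exchange : ∀ (f : StreamItem n) R S → ¬ Spans R f → Spans (S ++ R) f →
  ∃[ A ] ∃[ e ] ∃[ B ] S ≡ A ++ e ∷ B × ¬ Spans R e ×
    (∀ {x y} → Joined (S ++ R) x y → Joined (A ++ B ++ f ∷ R) x y)
exchange f R [] ¬sp sp = contradiction sp ¬sp
exchange f R (e ∷ S) ¬sp sp with spans? (S ++ R) f
... | yes sp′ =
  let A , g , B , S≡ , ¬g , sub = exchange f R S ¬sp sp′ in
  e ∷ A , g , B , cong (e ∷_) S≡ , ¬g ,
  joined-⊆ λ { (here refl) → spans-here e (A ++ B ++ f ∷ R)
             ; (there h∈)  → joined-∷ e (sub (spans-∈ h∈)) }
... | no ¬sp′ = [] , e , S , refl , ¬e , joined-⊆ λ { (here refl) → e-spanned ; (there h∈) → old (spans-∈ h∈) }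
  where
  old : ∀ {x y} → Joined (S ++ R) x y → Joined (S ++ f ∷ R) x y
  old = joined-⊆ λ h∈ → spans-∈ ([ ∈-++⁺ˡ , (λ h∈R → ∈-++⁺ʳ S (there h∈R)) ]′ (∈-++⁻ S h∈))
  f-spanned : Spans (S ++ f ∷ R) f
  f-spanned = spans-∈ (∈-++⁺ʳ S (here refl))
  split = joined-∷⁻ e (S ++ R) (src f) (tgt f) sp
  e-spanned : Spans (S ++ f ∷ R) e
  e-spanned with split
  ... | inj₁ sp′            = contradiction sp′ ¬sp′
  ... | inj₂ (inj₁ (p , q)) = joined-trans (joined-sym (old p)) (joined-trans f-spanned (old q))
  ... | inj₂ (inj₂ (p , q)) = joined-trans (joined-sym (old q)) (joined-trans (joined-sym f-spanned) (old p))
  ¬e : ¬ Spans R e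
  ¬e sp-e with split
  ... | inj₁ sp′            = ¬sp′ sp′
  ... | inj₂ (inj₁ (p , q)) = ¬sp′ (joined-trans p (joined-trans e′ (joined-sym q)))
    where
    e′ : Spans (S ++ R) e
    e′ = joined-⊆ (λ h∈ → spans-∈ (∈-++⁺ʳ S h∈)) sp-e
  ... | inj₂ (inj₂ (p , q)) = ¬sp′ (joined-trans p (joined-trans (joined-sym e′) (joined-sym q)))
    where
    e′ : Spans (S ++ R) e
    e′ = joined-⊆ (λ h∈ → spans-∈ (∈-++⁺ʳ S h∈)) sp-e

total-++-∷ : ∀ A (e : StreamItem n) B → total (A ++ e ∷ B) ≡ wt e + total (A ++ B)
total-++-∷ []      e B = refl
total-++-∷ (f ∷ A) e B = begin
  wt f + total (A ++ e ∷ B)      ≡⟨ cong (λ q → wt f + q) (total-++-∷ A e B) ⟩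
  wt f + (wt e + total (A ++ B)) ≡⟨ ℚ.+-assoc (wt f) (wt e) _ ⟨
  wt f + wt e + total (A ++ B)   ≡⟨ cong (_+ total (A ++ B)) (ℚ.+-comm (wt f) (wt e)) ⟩
  wt e + wt f + total (A ++ B)   ≡⟨ ℚ.+-assoc (wt e) (wt f) _ ⟩
  wt e + (wt f + total (A ++ B)) ∎
  where open ≡-Reasoning

total-nonNeg : ∀ {L : List (StreamItem n)} → (∀ {e} → e ∈ L → 0ℚ ≤ wt e) → 0ℚ ≤ total L
total-nonNeg {L = []}    _   = ℚ.≤-refl
total-nonNeg {L = _ ∷ _} pos = ℚ.+-mono-≤ (pos (here refl)) (total-nonNeg (pos ∘ there))


-- What is left of lightness when heavy edges are dropped from T.
Heavy : List (StreamItem n) → StreamItem n → Set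
Heavy T e = Light T e ⊎ All (λ f → wt f ≤ wt e) T

-- If `f` is heavier than `e`, it takes no part in the lightness of `e`, so `T` alone connects the
-- ends of `e`. Otherwise the order bounds all of `T` by `wt e`.
heavy-tail : ∀ {f : StreamItem n} {T e} → Descending (f ∷ T) → Heavy (f ∷ T) e →
  Heavy T e × (¬ Spans T e → wt f ≤ wt e)
heavy-tail (f≥ ∷ _) (inj₂ (f≤e ∷ T≤e)) = inj₂ T≤e , λ _ → f≤e
heavy-tail {f = f} {T} {e} (f≥ ∷ _) (inj₁ light) with wt f ≤? wt e
... | yes f≤e = inj₂ (All.map (λ g≤f → ℚ.≤-trans g≤f f≤e) f≥) , λ _ → f≤e
... | no  f≰e = inj₁ light′ , contradiction (light⇒spans {T = T} light′)
  where
  light′ : Light T e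
  light′ = subst (λ K → Spans K e) (filter-reject (λ g → wt g ≤? wt e) f≰e) light

-- From the lightest edge of T on, every edge of T takes the place of an edge
-- of S that is at least as heavy.
replace : ∀ {T S : List (StreamItem n)} → Forest T → Descending T → (∀ {e} → e ∈ S → Heavy T e) →
  (∀ {f} → f ∈ T → Spans S f) →
  ∃[ S′ ] (∀ {e} → e ∈ S′ → e ∈ S) × total T + total S′ ≤ total S ×
    (∀ {x y} → Joined S x y → Joined (S′ ++ T) x y)
replace {S = S} [] [] heavy spans =
  S , id , ℚ.≤-reflexive (ℚ.+-identityˡ _) , joined-⊆ (λ e∈ → spans-∈ (∈-++⁺ˡ e∈))
replace {T = f ∷ T} {S} (¬sp ∷ F) D@(_ ∷ D′) heavy spans
  with replace F D′ (λ e∈ → proj₁ (heavy-tail D (heavy e∈))) (spans ∘ there)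
... | S′ , sub , T+S′≤S , join with exchange f T S′ ¬sp (join (spans (here refl)))
... | A , e , B , refl , ¬e , join′ =
  A ++ B , sub ∘ widen , bound , λ p → subst (λ K → Joined K _ _) (sym (++-assoc A B (f ∷ T))) (join′ (join p))
  where
  widen : ∀ {g} → g ∈ A ++ B → g ∈ A ++ e ∷ B
  widen g∈ = [ ∈-++⁺ˡ , (λ g∈B → ∈-++⁺ʳ A (there g∈B)) ]′ (∈-++⁻ A g∈)
  f≤e : wt f ≤ wt e
  f≤e = proj₂ (heavy-tail D (heavy (sub (∈-++⁺ʳ A (here refl))))) ¬e
  open ℚ.≤-Reasoning
  bound : wt f + total T + total (A ++ B) ≤ total S
  bound = begin
    wt f + total T + total (A ++ B)   ≤⟨ ℚ.+-monoˡ-≤ (total (A ++ B)) (ℚ.+-monoˡ-≤ (total T) f≤e) ⟩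
    wt e + total T + total (A ++ B)   ≡⟨ cong (_+ total (A ++ B)) (ℚ.+-comm (wt e) (total T)) ⟩
    total T + wt e + total (A ++ B)   ≡⟨ ℚ.+-assoc (total T) (wt e) _ ⟩
    total T + (wt e + total (A ++ B)) ≡⟨ cong (λ q → total T + q) (total-++-∷ A e B) ⟨
    total T + total (A ++ e ∷ B)      ≤⟨ T+S′≤S ⟩
    total S                           ∎

-- Meant for the edge list of an expanded tour, where edges may repeat and be reversed; what
-- `replace` leaves over of it has nonnegative weight.
msf-minimal : ∀ {seen T S : List (StreamItem n)} → IsMSF seen T →
  (∀ {e} → e ∈ S → 0ℚ ≤ wt e × Light T e) → (∀ x y → Joined S x y) → total T ≤ total S
msf-minimal {T = T} {S} msf good spanning
  with replace forest descending (λ e∈ → inj₁ (proj₂ (good e∈))) (λ _ → spanning _ _)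
  where open IsMSF msf
... | S′ , sub , T+S′≤S , _ = begin
  total T            ≡⟨ ℚ.+-identityʳ (total T) ⟨
  total T + 0ℚ       ≤⟨ ℚ.+-monoʳ-≤ (total T) (total-nonNeg (λ e∈ → proj₁ (good (sub e∈)))) ⟩
  total T + total S′ ≤⟨ T+S′≤S ⟩
  total S            ∎
  where open ℚ.≤-Reasoning

-- The equation says a − b = p − q without subtraction.
≤-from : ∀ {p q a b} → p ≤ q → a + q ≡ p + b → a ≤ b
≤-from {p} {q} {a} {b} p≤q eq = ℚ.≤-trans (ℚ.≤-reflexive a≡) (ℚ.≤-trans (ℚ.+-monoˡ-≤ (b - q) p≤q) (ℚ.≤-reflexive b≡))
  where
  open +-*-Solver
  b≡ : q + (b - q) ≡ b
  b≡ = solve 2 (λ q b → q :+ (b :- q) := b) refl q b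
  a≡ : a ≡ p + (b - q)
  a≡ = begin
    a            ≡⟨ solve 2 (λ a q → a := a :+ q :- q) refl a q ⟩
    a + q - q    ≡⟨ cong (_- q) eq ⟩
    p + b - q    ≡⟨ ℚ.+-assoc p b _ ⟩
    p + (b - q)  ∎
    where open ≡-Reasoning

-- Weighted sums over the positions of a list

𝟙 : Bool → ℚ
𝟙 true  = 1ℚ
𝟙 false = 0ℚ

-- Sets of tree edges are functions on list positions, in accordance with the bit vector of marks
-- held in memory.
wsum : List (StreamItem n) → (ℕ → ℚ) → ℚ
wsum []      g = 0ℚ
wsum (f ∷ T) g = g 0 * wt f + wsum T (g ∘ suc)

mass : List (StreamItem n) → (ℕ → Bool) → ℚ
mass T g = wsum T (𝟙 ∘ g)

NonNegWeights : List (StreamItem n) → Set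
NonNegWeights L = ∀ {e} → e ∈ L → 0ℚ ≤ wt e

wsum-mono : ∀ {T : List (StreamItem n)} {g h} → NonNegWeights T →
  (∀ i → i ℕ.< length T → g i ≤ h i) → wsum T g ≤ wsum T h
wsum-mono {T = []}    _   _  = ℚ.≤-refl
wsum-mono {T = f ∷ T} pos le = ℚ.+-mono-≤
  (ℚ.*-monoʳ-≤-nonNeg (wt f) {{nonNegative (pos (here refl))}} (le 0 z<s))
  (wsum-mono (pos ∘ there) (λ i i< → le (suc i) (s<s i<)))

wsum-cong : ∀ (T : List (StreamItem n)) {g h} → (∀ i → i ℕ.< length T → g i ≡ h i) → wsum T g ≡ wsum T h
wsum-cong []      _  = refl
wsum-cong (f ∷ T) eq = cong₂ _+_ (cong (_* wt f) (eq 0 z<s)) (wsum-cong T (λ i i< → eq (suc i) (s<s i<)))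

wsum-+ : ∀ (T : List (StreamItem n)) g h → wsum T (λ i → g i + h i) ≡ wsum T g + wsum T h
wsum-+ []      g h = refl
wsum-+ (f ∷ T) g h = trans
  (cong (λ q → (g 0 + h 0) * wt f + q) (wsum-+ T (g ∘ suc) (h ∘ suc)))
  (solve 5 (λ a b w x y → (a :+ b) :* w :+ (x :+ y) := (a :* w :+ x) :+ (b :* w :+ y)) refl
    (g 0) (h 0) (wt f) (wsum T (g ∘ suc)) (wsum T (h ∘ suc)))
  where open +-*-Solver

wsum-0 : ∀ (T : List (StreamItem n)) → wsum T (λ _ → 0ℚ) ≡ 0ℚ
wsum-0 []      = refl
wsum-0 (f ∷ T) = trans (cong (λ q → 0ℚ * wt f + q) (wsum-0 T)) (trans (ℚ.+-identityʳ _) (ℚ.*-zeroˡ (wt f)))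

wsum-1 : ∀ (T : List (StreamItem n)) → wsum T (λ _ → 1ℚ) ≡ total T
wsum-1 []      = refl
wsum-1 (f ∷ T) = cong₂ _+_ (ℚ.*-identityˡ (wt f)) (wsum-1 T)

-- Fundamental cuts

side : List (StreamItem n) → StreamItem n → Fin n → Bool
side T f x = does (comp T x Fin.≟ comp T (src f))

-- cut T i is the indicator function of one side of the fundamental cut of the
-- i-th edge of the forest T.  Prepending f to T, the cut is corrected by the
-- cut of f whenever it separates the end vertices of f.
cut : List (StreamItem n) → ℕ → Fin n → Bool
cut []      i       x = false
cut (f ∷ T) zero    x = side T f x
cut (f ∷ T) (suc i) x = cut T i x xor (cut T i (src f) xor cut T i (tgt f)) ∧ side T f x

-- For a forest `T` that spans `e`, this is the tree path of `e`: a tree edge lies on it exactly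
-- when its fundamental cut separates the ends of `e`.
cov : List (StreamItem n) → StreamItem n → ℕ → Bool
cov T e i = cut T i (src e) xor cut T i (tgt e)

side-joined : ∀ {T : List (StreamItem n)} f {x y} → Joined T x y → side T f x ≡ side T f y
side-joined {T = T} f (joined p) = cong (λ c → does (c Fin.≟ comp T (src f))) p

side-src : ∀ (T : List (StreamItem n)) f → side T f (src f) ≡ true
side-src T f = dec-true (comp T (src f) Fin.≟ comp T (src f)) refl

side-tgt : ∀ (T : List (StreamItem n)) f → ¬ Spans T f → side T f (tgt f) ≡ false
side-tgt T f ¬sp = dec-false (comp T (tgt f) Fin.≟ comp T (src f)) (λ p → ¬sp (joined (sym p)))

-- The head edge is separated by its own cut. An older cut keeps its separated pair, because the
-- correction by `side T f` is constant on the components of `T`.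
cut-separates : ∀ {T : List (StreamItem n)} → Forest T → ∀ i → i ℕ.< length T →
  ∃[ x ] ∃[ y ] Joined T x y × cut T i x ≢ cut T i y
cut-separates {T = f ∷ T} (¬sp ∷ F) zero _ =
  src f , tgt f , spans-here f T ,
  λ eq → contradiction (trans (sym (side-src T f)) (trans eq (side-tgt T f ¬sp))) λ ()
cut-separates {T = f ∷ T} (¬sp ∷ F) (suc i) (ℕ.s<s i<) =
  let x , y , j , x≢y = cut-separates F i i< in
  x , y , joined-∷ f j , λ eq → x≢y (xor-cancelʳ _ _ (_ ∧ side T f y)
    (trans (cong (λ s → cut T i x xor _ ∧ s) (sym (side-joined f j))) eq))
  where
  xor-cancelʳ : ∀ a b c → a xor c ≡ b xor c → a ≡ b
  xor-cancelʳ true  true  _     _ = refl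
  xor-cancelʳ false false _     _ = refl
  xor-cancelʳ true  false true  ()
  xor-cancelʳ true  false false ()
  xor-cancelʳ false true  true  ()
  xor-cancelʳ false true  false ()

-- The boundary, over 𝔽₂ and evaluated at σ, of the set of edges chosen by g.
boundary : List (StreamItem n) → (ℕ → Bool) → (Fin n → Bool) → Bool
boundary []      g σ = false
boundary (f ∷ T) g σ = (g 0 ∧ (σ (src f) xor σ (tgt f))) xor boundary T (g ∘ suc) σ

boundary-xor : ∀ (T : List (StreamItem n)) g h σ →
  boundary T (λ i → g i xor h i) σ ≡ boundary T g σ xor boundary T h σ
boundary-xor []      g h σ = refl
boundary-xor (f ∷ T) g h σ = trans
  (cong (((g 0 xor h 0) ∧ ∂) xor_) (boundary-xor T (g ∘ suc) (h ∘ suc) σ))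
  (solve 5 (λ a b w x y → (a :+ b) :* w :+ (x :+ y) := (a :* w :+ x) :+ (b :* w :+ y)) refl
    (g 0) (h 0) ∂ (boundary T (g ∘ suc) σ) (boundary T (h ∘ suc) σ))
  where
  open xor-∧-Solver
  ∂ = σ (src f) xor σ (tgt f)

boundary-∧ : ∀ (T : List (StreamItem n)) g c σ → boundary T (λ i → g i ∧ c) σ ≡ boundary T g σ ∧ c
boundary-∧ []      g c σ = refl
boundary-∧ (f ∷ T) g c σ = trans
  (cong (((g 0 ∧ c) ∧ ∂) xor_) (boundary-∧ T (g ∘ suc) c σ))
  (solve 4 (λ a c w x → (a :* c) :* w :+ x :* c := (a :* w :+ x) :* c) refl
    (g 0) c ∂ (boundary T (g ∘ suc) σ))
  where
  open xor-∧-Solver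
  ∂ = σ (src f) xor σ (tgt f)

-- In a forest, the positions whose cut contains `x` form a chain whose boundary is `x` plus a term
-- common to the whole component; adding `σ x` leaves that common term.
potential : List (StreamItem n) → (Fin n → Bool) → Fin n → Bool
potential T σ x = boundary T (λ i → cut T i x) σ xor σ x

-- By linearity of `boundary`, the potential obeys the same correction formula as `cut`; the
-- contribution of the new head edge supplies the missing values of `σ`.
potential-∷ : ∀ (f : StreamItem n) T σ x → potential (f ∷ T) σ x ≡
  potential T σ x xor (potential T σ (src f) xor potential T σ (tgt f)) ∧ side T f x
potential-∷ f T σ x = begin
  (s ∧ (σ a xor σ b) xor boundary T (λ i → cut T i x xor (cut T i a xor cut T i b) ∧ s) σ) xor σ x
    ≡⟨ cong (λ z → (s ∧ (σ a xor σ b) xor z) xor σ x)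
         (trans (boundary-xor T (λ i → cut T i x) (λ i → (cut T i a xor cut T i b) ∧ s) σ)
           (cong (bd x xor_) (trans (boundary-∧ T (λ i → cut T i a xor cut T i b) s σ)
             (cong (_∧ s) (boundary-xor T (λ i → cut T i a) (λ i → cut T i b) σ))))) ⟩
  (s ∧ (σ a xor σ b) xor (bd x xor (bd a xor bd b) ∧ s)) xor σ x
    ≡⟨ solve 7 (λ s σa σb σx x a b → (s :* (σa :+ σb) :+ (x :+ (a :+ b) :* s)) :+ σx
                                   := (x :+ σx) :+ ((a :+ σa) :+ (b :+ σb)) :* s) refl
         s (σ a) (σ b) (σ x) (bd x) (bd a) (bd b) ⟩
  (bd x xor σ x) xor ((bd a xor σ a) xor (bd b xor σ b)) ∧ s ∎
  where
  open ≡-Reasoning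
  open xor-∧-Solver
  a = src f
  b = tgt f
  s = side T f x
  bd : Fin _ → Bool
  bd y = boundary T (λ i → cut T i y) σ

-- It suffices to compare the ends of each edge. At the head edge the correction acts on the source
-- only and turns its value into that of the target; along older edges `side` is constant.
potential-joined : ∀ {T : List (StreamItem n)} → Forest T → ∀ σ {x y} → Joined T x y →
  potential T σ x ≡ potential T σ y
potential-joined {T = T} F σ = joined-universal (potential T σ) T (edge F)
  where
  edge : ∀ {T} → Forest T → ∀ {e} → e ∈ T → potential T σ (src e) ≡ potential T σ (tgt e)
  cancel : ∀ a b → a xor (a xor b) ∧ true ≡ b xor (a xor b) ∧ false
  cancel = solve 2 (λ a b → a :+ (a :+ b) :* con true := b :+ (a :+ b) :* con false) refl
    where open xor-∧-Solver
  edge {f ∷ T} (¬sp ∷ F) (here refl) = begin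
    potential (f ∷ T) σ (src f)               ≡⟨ potential-∷ f T σ (src f) ⟩
    pa xor (pa xor pb) ∧ side T f (src f)     ≡⟨ cong (λ s → pa xor (pa xor pb) ∧ s) (side-src T f) ⟩
    pa xor (pa xor pb) ∧ true                 ≡⟨ cancel pa pb ⟩
    pb xor (pa xor pb) ∧ false                ≡⟨ cong (λ s → pb xor (pa xor pb) ∧ s) (side-tgt T f ¬sp) ⟨
    pb xor (pa xor pb) ∧ side T f (tgt f)     ≡⟨ potential-∷ f T σ (tgt f) ⟨
    potential (f ∷ T) σ (tgt f)               ∎
    where
    open ≡-Reasoning
    pa = potential T σ (src f)
    pb = potential T σ (tgt f)
  edge {f ∷ T} (¬sp ∷ F) {e} (there e∈) =
    trans (potential-∷ f T σ (src e))
      (trans (cong₂ (λ p s → p xor (potential T σ (src f) xor potential T σ (tgt f)) ∧ s)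
               (edge F e∈) (side-joined f (spans-∈ e∈)))
        (sym (potential-∷ f T σ (tgt e))))

-- The edges of T covered by e form a path with the end vertices of e.
boundary-cov : ∀ {T : List (StreamItem n)} → Forest T → ∀ e → Spans T e → ∀ σ →
  boundary T (cov T e) σ ≡ σ (src e) xor σ (tgt e)
boundary-cov {T = T} F e sp σ = trans (boundary-xor T (λ i → cut T i (src e)) (λ i → cut T i (tgt e)) σ)
  (finish (bd (src e)) (bd (tgt e)) _ _ (potential-joined F σ sp))
  where
  bd : Fin _ → Bool
  bd y = boundary T (λ i → cut T i y) σ
  finish : ∀ a b c d → a xor c ≡ b xor d → a xor b ≡ c xor d
  finish a b c d eq = begin
    a xor b                 ≡⟨ solve 3 (λ a b c → a :+ b := (a :+ c) :+ (b :+ c)) refl a b c ⟩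
    (a xor c) xor (b xor c) ≡⟨ cong (_xor (b xor c)) eq ⟩
    (b xor d) xor (b xor c) ≡⟨ solve 3 (λ b c d → (b :+ d) :+ (b :+ c) := c :+ d) refl b c d ⟩
    c xor d                 ∎
    where
    open ≡-Reasoning
    open xor-∧-Solver

-- Choosing half of a cover

covers parity : List (StreamItem n) → List (StreamItem n) → ℕ → Bool
covers T []      i = false
covers T (e ∷ E) i = cov T e i ∨ covers T E i
parity T []      i = false
parity T (e ∷ E) i = cov T e i xor parity T E i

-- Twice the probability that p and a uniformly random subset of E together
-- hit an edge an odd number of times; the first argument says whether E
-- covers the edge.
twiceOdd : Bool → Bool → ℚ
twiceOdd true  _ = 1ℚ
twiceOdd false p = 𝟙 p + 𝟙 p

twiceOdd-average : ∀ c k p → twiceOdd k p + twiceOdd k (p xor c) ≡ twiceOdd (c ∨ k) p + twiceOdd (c ∨ k) p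
twiceOdd-average true  true  _     = refl
twiceOdd-average true  false true  = refl
twiceOdd-average true  false false = refl
twiceOdd-average false true  _     = refl
twiceOdd-average false false true  = refl
twiceOdd-average false false false = refl

-- Method of conditional expectations. A uniformly random `J` attains the bound on average, since
-- `total J` has mean half of `total E`; the coins are fixed one by one, and `p` holds the parities
-- due to those already fixed.
halving : ∀ (T E : List (StreamItem n)) (p : ℕ → Bool) → ∃[ J ] (∀ {e} → e ∈ J → e ∈ E) ×
  wsum T (λ i → twiceOdd (covers T E i) (p i)) + (total J + total J) ≤
  mass T (λ i → p i xor parity T J i) + mass T (λ i → p i xor parity T J i) + total E
halving T [] p = [] , id , ℚ.≤-reflexive (cong (_+ 0ℚ)
  (trans (wsum-+ T (𝟙 ∘ p) (𝟙 ∘ p)) (cong₂ _+_ eq eq)))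
  where
  eq : mass T p ≡ mass T (λ i → p i xor false)
  eq = wsum-cong T (λ i _ → cong 𝟙 (sym (Bool.xor-identityʳ (p i))))
halving T (e ∷ E) p
  with halving T E p | halving T E (λ i → p i xor cov T e i)
     | wsum T (λ i → twiceOdd (covers T (e ∷ E) i) (p i)) ≤? wsum T (λ i → twiceOdd (covers T E i) (p i)) + wt e
... | J , J⊆E , bound | _ | yes le = J , there ∘ J⊆E ,
  ≤-from (ℚ.+-mono-≤ bound le)
    (solve 6 (λ Q Q₁ j m t w → (Q :+ (j :+ j)) :+ ((m :+ m :+ t) :+ (Q₁ :+ w))
                            := ((Q₁ :+ (j :+ j)) :+ Q) :+ (m :+ m :+ (w :+ t))) refl
      (wsum T (λ i → twiceOdd (covers T (e ∷ E) i) (p i))) (wsum T (λ i → twiceOdd (covers T E i) (p i)))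
      (total J) (mass T (λ i → p i xor parity T J i)) (total E) (wt e))
  where open +-*-Solver
-- `Q` is the mean of `Q₁` and `Q₂` and exceeds `Q₁ + wt e`, so `Q₂` exceeds `Q + wt e`, which pays
-- for choosing `e`.
... | _ | J , J⊆E , bound | no nle = e ∷ J , sub ,
  subst (λ m → Q + (total (e ∷ J) + total (e ∷ J)) ≤ m + m + total (e ∷ E)) mass≡
    (≤-from (ℚ.+-mono-≤ (ℚ.+-mono-≤ bound (ℚ.<⇒≤ (ℚ.≰⇒> nle))) (ℚ.≤-reflexive average))
      (solve 7 (λ Q Q₁ Q₂ j m t w →
          (Q :+ ((w :+ j) :+ (w :+ j))) :+ (((m :+ m :+ t) :+ Q) :+ (Q₁ :+ Q₂))
        := (((Q₂ :+ (j :+ j)) :+ (Q₁ :+ w)) :+ (Q :+ Q)) :+ (m :+ m :+ (w :+ t))) refl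
        Q Q₁ Q₂ (total J) M (total E) (wt e)))
  where
  open +-*-Solver
  p′ : ℕ → Bool
  p′ i = p i xor cov T e i
  Q Q₁ Q₂ M : ℚ
  Q  = wsum T (λ i → twiceOdd (covers T (e ∷ E) i) (p i))
  Q₁ = wsum T (λ i → twiceOdd (covers T E i) (p i))
  Q₂ = wsum T (λ i → twiceOdd (covers T E i) (p′ i))
  M  = mass T (λ i → p′ i xor parity T J i)
  average : Q + Q ≡ Q₁ + Q₂
  average = trans (sym (wsum-+ T _ _))
    (trans (wsum-cong T (λ i _ → sym (twiceOdd-average (cov T e i) (covers T E i) (p i)))) (wsum-+ T _ _))
  mass≡ : M ≡ mass T (λ i → p i xor parity T (e ∷ J) i)
  mass≡ = wsum-cong T (λ i _ → cong 𝟙 (Bool.xor-assoc (p i) (cov T e i) (parity T J i)))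
  sub : ∀ {f} → f ∈ e ∷ J → f ∈ e ∷ E
  sub (here eq) = here eq
  sub (there f∈) = there (J⊆E f∈)

-- Greedy covers

bit : ∀ {m} → Vec Bool m → ℕ → Bool
bit []       _       = false
bit (b ∷ _)  zero    = b
bit (_ ∷ bs) (suc i) = bit bs i

bits : (ℕ → Bool) → ∀ m → Vec Bool m
bits g zero    = []
bits g (suc m) = g 0 ∷ bits (g ∘ suc) m

bit-bits : ∀ g {m i} → i ℕ.< m → bit (bits g m) i ≡ g i
bit-bits g {suc m} {zero}  _          = refl
bit-bits g {suc m} {suc i} (ℕ.s<s i<) = bit-bits (g ∘ suc) i<

gain : List (StreamItem n) → (ℕ → Bool) → StreamItem n → ℚ
gain T C e = mass T (λ i → cov T e i ∧ not (C i))

-- Every ratio r with (1 − 1/r)(1 − r/2) ≥ 2/25 in place of 3/2 would do.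
Profitable : List (StreamItem n) → (ℕ → Bool) → StreamItem n → Set
Profitable T C e = wt e + wt e + wt e ≤ gain T C e + gain T C e

mark : List (StreamItem n) → Vec Bool n → StreamItem n → Vec Bool n
mark {n} T C e with wt e + wt e + wt e ≤? gain T (bit C) e + gain T (bit C) e
... | yes _ = bits (λ i → bit C i ∨ cov T e i) n
... | no  _ = C

-- The list `cover` lives in the analysis only; memory holds just `C`. `cheap` and `exhaustive` are
-- the two sides of the threshold 3/2, cleared of fractions.
record IsCover {n : ℕ} (T seen : List (StreamItem n)) (C : ℕ → Bool) : Set where
  field
    cover      : List (StreamItem n)
    subset     : ∀ {e} → e ∈ cover → e ∈ seen
    covered    : ∀ i → i ℕ.< length T → C i ≡ covers T cover i
    cheap      : total cover + total cover + total cover ≤ mass T C + mass T C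
    exhaustive : ∀ {e} → e ∈ seen → gain T C e + gain T C e ≤ wt e + wt e + wt e

IsCover-[] : ∀ (T : List (StreamItem n)) → IsCover T [] (λ _ → false)
IsCover-[] T = record
  { cover = [] ; subset = λ () ; covered = λ _ _ → refl
  ; cheap = ℚ.≤-reflexive (sym (cong₂ _+_ (wsum-0 T) (wsum-0 T)))
  ; exhaustive = λ () }

IsCover-cong : ∀ {T seen : List (StreamItem n)} {C D} → (∀ i → i ℕ.< length T → C i ≡ D i) →
  IsCover T seen C → IsCover T seen D
IsCover-cong {T = T} {C = C} {D} eq K = record
  { cover = cover ; subset = subset
  ; covered = λ i i< → trans (sym (eq i i<)) (covered i i<)
  ; cheap = subst (λ m → total cover + total cover + total cover ≤ m + m)
      (wsum-cong T (λ i i< → cong 𝟙 (eq i i<))) cheap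
  ; exhaustive = λ {e} e∈ → subst (λ g → g + g ≤ wt e + wt e + wt e)
      (wsum-cong T (λ i i< → cong (λ c → 𝟙 (cov T e i ∧ not c)) (eq i i<))) (exhaustive e∈) }
  where open IsCover K

𝟙-∨ : ∀ c k → 𝟙 (c ∨ k) ≡ 𝟙 c + 𝟙 (k ∧ not c)
𝟙-∨ true  true  = refl
𝟙-∨ true  false = refl
𝟙-∨ false true  = refl
𝟙-∨ false false = refl

mass-∨ : ∀ (T : List (StreamItem n)) (C : ℕ → Bool) e → mass T (λ i → C i ∨ cov T e i) ≡ mass T C + gain T C e
mass-∨ T C e = trans (wsum-cong T (λ i _ → 𝟙-∨ (C i) (cov T e i))) (wsum-+ T _ _)

-- This makes one greedy pass enough: an edge that was refused would be refused again under all
-- later marks.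
gain-antitone : ∀ {T : List (StreamItem n)} → NonNegWeights T → ∀ (C D : ℕ → Bool) e →
  gain T (λ i → C i ∨ D i) e ≤ gain T C e
gain-antitone {T = T} pos C D e = wsum-mono pos (λ i _ → le (cov T e i) (C i) (D i))
  where
  0≤1 : 0ℚ ≤ 1ℚ
  0≤1 = ℚ.nonNegative⁻¹ 1ℚ
  le : ∀ k c d → 𝟙 (k ∧ not (c ∨ d)) ≤ 𝟙 (k ∧ not c)
  le false _     _     = ℚ.≤-refl
  le true  true  _     = ℚ.≤-refl
  le true  false true  = 0≤1
  le true  false false = ℚ.≤-refl

gain-covered : ∀ (T : List (StreamItem n)) (C : ℕ → Bool) e → gain T (λ i → C i ∨ cov T e i) e ≡ 0ℚ
gain-covered T C e = trans (wsum-cong T (λ i _ → cong 𝟙 (none (cov T e i) (C i)))) (wsum-0 T)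
  where
  none : ∀ k c → k ∧ not (c ∨ k) ≡ false
  none true  c = cong not (Bool.∨-zeroʳ c)
  none false c = refl

double-mono : ∀ {p q} → p ≤ q → p + p ≤ q + q
double-mono p≤q = ℚ.+-mono-≤ p≤q p≤q

IsCover-extend : ∀ {T seen : List (StreamItem n)} {C e} → NonNegWeights T → 0ℚ ≤ wt e → Profitable T C e →
  IsCover T seen C → IsCover T (e ∷ seen) (λ i → C i ∨ cov T e i)
IsCover-extend {T = T} {seen} {C} {e} pos 0≤e prof K = record
  { cover = e ∷ cover
  ; subset = λ { (here p) → here p ; (there f∈) → there (subset f∈) }
  ; covered = λ i i< → trans (cong (_∨ cov T e i) (covered i i<)) (Bool.∨-comm (covers T cover i) (cov T e i))
  ; cheap = subst (λ m → w + c + (w + c) + (w + c) ≤ m + m) (sym (mass-∨ T C e))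
      (≤-from (ℚ.+-mono-≤ cheap prof) (rearrange w c (mass T C) (gain T C e)))
  ; exhaustive = λ
      { (here refl)    → subst (λ g → g + g ≤ w + w + w) (sym (gain-covered T C e))
                           (ℚ.+-mono-≤ (ℚ.+-mono-≤ 0≤e 0≤e) 0≤e)
      ; {f} (there f∈) → ℚ.≤-trans (double-mono (gain-antitone pos C (cov T e) f)) (exhaustive f∈) }
  }
  where
  open IsCover K
  w = wt e
  c = total cover
  rearrange : ∀ w c m g → (w + c + (w + c) + (w + c)) + ((m + m) + (g + g)) ≡
    ((c + c + c) + (w + w + w)) + ((m + g) + (m + g))
  rearrange = solve 4 (λ w c m g → (w :+ c :+ (w :+ c) :+ (w :+ c)) :+ ((m :+ m) :+ (g :+ g)) :=
    ((c :+ c :+ c) :+ (w :+ w :+ w)) :+ ((m :+ g) :+ (m :+ g))) refl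
    where open +-*-Solver

IsCover-skip : ∀ {T seen : List (StreamItem n)} {C e} → ¬ Profitable T C e →
  IsCover T seen C → IsCover T (e ∷ seen) C
IsCover-skip ¬prof K = record
  { cover = cover ; subset = there ∘ subset ; covered = covered ; cheap = cheap
  ; exhaustive = λ { (here refl) → ℚ.<⇒≤ (ℚ.≰⇒> ¬prof) ; (there e∈) → exhaustive e∈ } }
  where open IsCover K

mark-IsCover : ∀ {T seen : List (StreamItem n)} {C e} → length T ℕ.≤ n → NonNegWeights T → 0ℚ ≤ wt e →
  IsCover T seen (bit C) → IsCover T (e ∷ seen) (bit (mark T C e))
mark-IsCover {n} {T} {C = C} {e} len pos 0≤e K
  with wt e + wt e + wt e ≤? gain T (bit C) e + gain T (bit C) e
... | yes prof  = IsCover-cong (λ i i< → sym (bit-bits (λ i → bit C i ∨ cov T e i) (ℕ.<-≤-trans i< len)))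
                    (IsCover-extend pos 0≤e prof K)
... | no  ¬prof = IsCover-skip ¬prof K

-- Counting crossings

crossings : (Fin n → Bool) → List (StreamItem n) → ℚ
crossings σ []      = 0ℚ
crossings σ (e ∷ S) = 𝟙 (σ (src e) xor σ (tgt e)) + crossings σ S

-- Double counting of pairs of an uncovered tree edge and an edge of `S` crossing its cut: every
-- uncovered tree edge is in at least two pairs, and those of a fixed `e` weigh `gain T C e`, at
-- most 3/2 of its weight.
uncovered-bound : ∀ {T : List (StreamItem n)} {C} → NonNegWeights T → ∀ S →
  (∀ i → i ℕ.< length T → 1ℚ + 1ℚ ≤ crossings (cut T i) S) →
  (∀ {e} → e ∈ S → gain T C e + gain T C e ≤ wt e + wt e + wt e) →
  let r = mass T (not ∘ C) in (r + r) + (r + r) ≤ total S + total S + total S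
uncovered-bound {T = T} {C} pos S twice ex = begin
  (r + r) + (r + r)            ≡⟨ cong₂ _+_ rr rr ⟩
  wsum T (λ i → 𝟙 (not (C i)) + 𝟙 (not (C i))) + wsum T (λ i → 𝟙 (not (C i)) + 𝟙 (not (C i)))
                               ≤⟨ double-mono (wsum-mono pos (λ i i< → pointwise i (twice i i<))) ⟩
  wsum T (count S) + wsum T (count S)   ≤⟨ sum-bound S ex ⟩
  total S + total S + total S  ∎
  where
  open ℚ.≤-Reasoning
  r = mass T (not ∘ C)
  rr : r + r ≡ wsum T (λ i → 𝟙 (not (C i)) + 𝟙 (not (C i)))
  rr = sym (wsum-+ T _ _)
  count : List (StreamItem _) → ℕ → ℚ
  count []      i = 0ℚ
  count (e ∷ S) i = 𝟙 (cov T e i ∧ not (C i)) + count S i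
  count-true : ∀ S i → C i ≡ true → count S i ≡ 0ℚ
  count-true []      i _  = refl
  count-true (e ∷ S) i eq rewrite eq | Bool.∧-zeroʳ (cov T e i) | count-true S i eq = refl
  count-false : ∀ S i → C i ≡ false → count S i ≡ crossings (cut T i) S
  count-false []      i _  = refl
  count-false (e ∷ S) i eq rewrite eq | Bool.∧-identityʳ (cov T e i) | count-false S i eq = refl
  pointwise : ∀ i → 1ℚ + 1ℚ ≤ crossings (cut T i) S → 𝟙 (not (C i)) + 𝟙 (not (C i)) ≤ count S i
  pointwise i le with C i in eq
  ... | true  = ℚ.≤-reflexive (sym (count-true S i eq))
  ... | false = ℚ.≤-trans le (ℚ.≤-reflexive (sym (count-false S i eq)))
  sum-bound : ∀ S → (∀ {e} → e ∈ S → gain T C e + gain T C e ≤ wt e + wt e + wt e) →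
    wsum T (count S) + wsum T (count S) ≤ total S + total S + total S
  sum-bound []      _  = ℚ.≤-reflexive (cong₂ _+_ (wsum-0 T) (wsum-0 T))
  sum-bound (e ∷ S) ex = subst (λ m → m + m ≤ _) (sym (wsum-+ T _ _))
    (≤-from (ℚ.+-mono-≤ (ex (here refl)) (sum-bound S (ex ∘ there)))
      (rearrange (gain T C e) (wsum T (count S)) (wt e) (total S)))
    where
    rearrange : ∀ g c w t → ((g + c) + (g + c)) + ((w + w + w) + (t + t + t)) ≡
      ((g + g) + (c + c)) + (w + t + (w + t) + (w + t))
    rearrange = solve 4 (λ g c w t → ((g :+ c) :+ (g :+ c)) :+ ((w :+ w :+ w) :+ (t :+ t :+ t)) :=
      ((g :+ g) :+ (c :+ c)) :+ (w :+ t :+ (w :+ t) :+ (w :+ t))) refl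
      where open +-*-Solver

-- Euler tours

oddness : (Fin n → Bool) → List (StreamItem n) → Bool
oddness σ []      = false
oddness σ (e ∷ M) = (σ (src e) xor σ (tgt e)) xor oddness σ M

oddness-++ : ∀ (σ : Fin n → Bool) A B → oddness σ (A ++ B) ≡ oddness σ A xor oddness σ B
oddness-++ σ []      B = refl
oddness-++ σ (e ∷ A) B = trans (cong ((σ (src e) xor σ (tgt e)) xor_) (oddness-++ σ A B))
  (sym (Bool.xor-assoc (σ (src e) xor σ (tgt e)) (oddness σ A) (oddness σ B)))

oddness-witness : ∀ (σ : Fin n → Bool) M → oddness σ M ≡ true →
  ∃[ e ] e ∈ M × σ (src e) xor σ (tgt e) ≡ true
oddness-witness σ (e ∷ M) odd with σ (src e) xor σ (tgt e) in eq
... | true  = e , here refl , eq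
... | false = let f , f∈ , p = oddness-witness σ M odd in f , there f∈ , p

Unique⇒↭allFin : {xs : List (Fin n)} → Unique xs → (∀ x → x ∈ xs) → xs ↭ allFin n
Unique⇒↭allFin {n} uniq all = ∼bag⇒↭ (unique∧set⇒bag uniq (allFin⁺ n) (λ {x} → mk⇔ (λ _ → ∈-allFin x) (λ _ → all x)))

-- The cut around a single vertex: `oddness (δ t) M` is the parity of the degree of `t`.
δ : Fin n → Fin n → Bool
δ t x = does (x Fin.≟ t)

δ-true : ∀ (t : Fin n) {x} → δ t x ≡ true → x ≡ t
δ-true t {x} eq with x Fin.≟ t
... | yes p = p

mem : List (Fin n) → Fin n → Bool
mem xs x = does (member? Fin._≟_ x xs)

mem-true : ∀ (xs : List (Fin n)) {x} → mem xs x ≡ true → x ∈ xs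
mem-true xs {x} eq with member? Fin._≟_ x xs
... | yes p = p

Ends : StreamItem n → Fin n → Fin n → Set
Ends e t y = (t ≡ src e × y ≡ tgt e) ⊎ (t ≡ tgt e × y ≡ src e)

ends-xor : ∀ {e : StreamItem n} {t y} → Ends e t y → ∀ (σ : Fin n → Bool) → σ (src e) xor σ (tgt e) ≡ σ t xor σ y
ends-xor         (inj₁ (refl , refl)) σ = refl
ends-xor {e = e} (inj₂ (refl , refl)) σ = Bool.xor-comm (σ (src e)) (σ (tgt e))

ends-≡ : ∀ {A : Set} {e : StreamItem n} {t y} → Ends e t y → ∀ (σ : Fin n → A) → σ t ≡ σ y → σ (src e) ≡ σ (tgt e)
ends-≡ (inj₁ (refl , refl)) σ eq = eq
ends-≡ (inj₂ (refl , refl)) σ eq = sym eq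

-- An Euler trail in the making: vs leads from u to t, and M is the list of
-- unused edges.  Evenness and connectivity are stated by means of cuts.
record Trail {n : ℕ} (M : List (StreamItem n)) (u : Fin n) (vs : List (Fin n)) (t : Fin n) : Set where
  field
    even      : ∀ σ → (σ u xor σ t) xor oddness σ M ≡ false
    connected : ∀ (σ : Fin n → Bool) → (∀ {x} → x ∈ u ∷ t ∷ vs → σ x ≡ σ u) →
      (∀ {e} → e ∈ M → σ (src e) ≡ σ (tgt e)) → ∀ x → σ x ≡ σ u

module _ (d : Fin n → Fin n → ℚ) where

  walkWeight-++ : ∀ u vs t ws y → walkWeight d u (vs ++ t ∷ ws) y ≡ walkWeight d u vs t + walkWeight d t ws y
  walkWeight-++ u []       t ws y = refl
  walkWeight-++ u (v ∷ vs) t ws y =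
    trans (cong (λ q → d u v + q) (walkWeight-++ v vs t ws y)) (sym (ℚ.+-assoc (d u v) _ _))

  trail-rotate : ∀ {M u vs z} → Trail M u vs u → z ∈ u ∷ vs →
    ∃[ ws ] Trail M z ws z × walkWeight d z ws z ≡ walkWeight d u vs u
  trail-rotate {vs = vs} tr (here refl) = vs , tr , refl
  trail-rotate {u = u} {z = z} tr (there z∈) with ∈-∃++ z∈
  ... | as , bs , refl = bs ++ u ∷ as ,
    record { even = λ σ → trans (cong (_xor _) (trans (Bool.xor-same (σ z)) (sym (Bool.xor-same (σ u))))) (even σ)
           ; connected = λ σ same edges x →
               trans (connected σ (λ y∈ → trans (same (back y∈)) (sym (same (back (here refl))))) edges x)
                     (same (back (here refl))) } ,
    trans (walkWeight-++ z bs u as z)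
      (trans (ℚ.+-comm (walkWeight d z bs u) (walkWeight d u as z)) (sym (walkWeight-++ u as z bs u)))
    where
    open Trail tr
    back : ∀ {y} → y ∈ u ∷ u ∷ as ++ z ∷ bs → y ∈ z ∷ z ∷ bs ++ u ∷ as
    back (here p)         = there (there (∈-++⁺ʳ bs (here p)))
    back (there (here p)) = there (there (∈-++⁺ʳ bs (here p)))
    back (there (there y∈)) with ∈-++⁻ as y∈
    ... | inj₁ y∈as         = there (there (∈-++⁺ʳ bs (there y∈as)))
    ... | inj₂ (here p)     = here p
    ... | inj₂ (there y∈bs) = there (there (∈-++⁺ˡ y∈bs))

  trail-extend : ∀ A e B {u vs t y} → Ends e t y →
    Trail (A ++ e ∷ B) u vs t → Trail (A ++ B) u (vs ++ t ∷ []) y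
  trail-extend A e B {u} {vs} {t} {y} ends tr = record { even = even′ ; connected = connected′ }
    where
    open Trail tr
    even′ : ∀ σ → (σ u xor σ y) xor oddness σ (A ++ B) ≡ false
    even′ σ = begin
      (σ u xor σ y) xor oddness σ (A ++ B)
        ≡⟨ cong ((σ u xor σ y) xor_) (oddness-++ σ A B) ⟩
      (σ u xor σ y) xor (oddness σ A xor oddness σ B)
        ≡⟨ solve 5 (λ u y t a b → (u :+ y) :+ (a :+ b) := (u :+ t) :+ (a :+ ((t :+ y) :+ b))) refl
             (σ u) (σ y) (σ t) (oddness σ A) (oddness σ B) ⟩
      (σ u xor σ t) xor (oddness σ A xor ((σ t xor σ y) xor oddness σ B))
        ≡⟨ cong (λ z → (σ u xor σ t) xor (oddness σ A xor (z xor oddness σ B))) (ends-xor {e = e} ends σ) ⟨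
      (σ u xor σ t) xor (oddness σ A xor oddness σ (e ∷ B))
        ≡⟨ cong ((σ u xor σ t) xor_) (oddness-++ σ A (e ∷ B)) ⟨
      (σ u xor σ t) xor oddness σ (A ++ e ∷ B)
        ≡⟨ even σ ⟩
      false ∎
      where
      open ≡-Reasoning
      open xor-∧-Solver
    connected′ : ∀ (σ : Fin n → Bool) → (∀ {x} → x ∈ u ∷ y ∷ vs ++ t ∷ [] → σ x ≡ σ u) →
      (∀ {f} → f ∈ A ++ B → σ (src f) ≡ σ (tgt f)) → ∀ x → σ x ≡ σ u
    connected′ σ same edges = connected σ
      (λ { (here p) → same (here p) ; (there (here p)) → same (there (there (∈-++⁺ʳ vs (here p))))
         ; (there (there x∈)) → same (there (there (∈-++⁺ˡ x∈))) }) edges′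
      where
      σt≡σy : σ t ≡ σ y
      σt≡σy = trans (same (there (there (∈-++⁺ʳ vs (here refl))))) (sym (same (there (here refl))))
      edges′ : ∀ {f} → f ∈ A ++ e ∷ B → σ (src f) ≡ σ (tgt f)
      edges′ f∈ with ∈-++⁻ A f∈
      ... | inj₁ f∈A         = edges (∈-++⁺ˡ f∈A)
      ... | inj₂ (there f∈B) = edges (∈-++⁺ʳ A f∈B)
      ... | inj₂ (here refl) = ends-≡ {e = e} ends σ σt≡σy

  module _ (d-sym : ∀ x y → d x y ≡ d y x) where

    ends-≤ : ∀ {e t y} → Ends e t y → d (src e) (tgt e) ≤ wt e → d t y ≤ wt e
    ends-≤         (inj₁ (refl , refl)) le = le
    ends-≤ {e = e} (inj₂ (refl , refl)) le = subst (_≤ wt e) (d-sym (src e) (tgt e)) le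

    -- Hierholzer: an open trail ends in a vertex with an unused edge, and a
    -- closed trail that is not yet finished meets an unused edge.
    euler : ∀ k M u vs t → length M ≡ k → Trail M u vs t → (∀ {e} → e ∈ M → d (src e) (tgt e) ≤ wt e) →
      ∃[ v ] ∃[ ws ] (∀ x → x ∈ v ∷ ws) × walkWeight d v ws v ≤ walkWeight d u vs t + total M

    absorb : ∀ k M e u vs t y → length M ≡ suc k → Trail M u vs t → (∀ {e} → e ∈ M → d (src e) (tgt e) ≤ wt e) →
      e ∈ M → Ends e t y →
      ∃[ v ] ∃[ ws ] (∀ x → x ∈ v ∷ ws) × walkWeight d v ws v ≤ walkWeight d u vs t + total M
    absorb k M e u vs t y len tr le e∈ ends with ∈-∃++ e∈
    ... | A , B , refl =
      let v , ws , all , bound = euler k (A ++ B) u (vs ++ t ∷ []) y len′ (trail-extend A e B ends tr) (le ∘ widen) in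
      v , ws , all , ℚ.≤-trans bound (ℚ.≤-trans (ℚ.+-monoˡ-≤ (total (A ++ B)) new) (ℚ.≤-reflexive assoc))
      where
      len′ : length (A ++ B) ≡ k
      len′ = ℕ.suc-injective (begin
        suc (length (A ++ B))         ≡⟨ cong suc (length-++ A) ⟩
        suc (length A ℕ.+ length B)   ≡⟨ ℕ.+-suc (length A) (length B) ⟨
        length A ℕ.+ length (e ∷ B)   ≡⟨ length-++ A ⟨
        length (A ++ e ∷ B)           ≡⟨ len ⟩
        suc k                         ∎)
        where open ≡-Reasoning
      widen : ∀ {f} → f ∈ A ++ B → f ∈ A ++ e ∷ B
      widen f∈ = [ ∈-++⁺ˡ , (λ f∈B → ∈-++⁺ʳ A (there f∈B)) ]′ (∈-++⁻ A f∈)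
      dty : d t y ≤ wt e
      dty = ends-≤ {e} ends (le e∈)
      new : walkWeight d u (vs ++ t ∷ []) y ≤ walkWeight d u vs t + wt e
      new = subst (_≤ walkWeight d u vs t + wt e) (sym (walkWeight-++ u vs t [] y))
        (ℚ.+-monoʳ-≤ (walkWeight d u vs t) dty)
      assoc : walkWeight d u vs t + wt e + total (A ++ B) ≡ walkWeight d u vs t + total (A ++ e ∷ B)
      assoc = trans (ℚ.+-assoc (walkWeight d u vs t) (wt e) (total (A ++ B)))
        (cong (λ q → walkWeight d u vs t + q) (sym (total-++-∷ A e B)))

    euler k [] u vs t len tr le = u , vs , all ,
      ℚ.≤-reflexive (trans (cong (walkWeight d u vs) u≡t) (sym (ℚ.+-identityʳ _)))
      where
      open Trail tr
      -- With no edge left, evenness at the cut around `t` forces the trail to be closed.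
      u≡t : u ≡ t
      u≡t with δ t u in eq
      ... | true  = δ-true t eq
      ... | false with () ← trans (sym (cong₂ (λ a b → (a xor b) xor false) eq (dec-true (t Fin.≟ t) refl)))
                              (even (δ t))
      all : ∀ x → x ∈ u ∷ vs
      all x = mem-true (u ∷ vs) (trans
        (connected (mem (u ∷ vs)) (λ y∈ → trans (in-true (fold y∈)) (sym (in-true (here refl)))) (λ ()) x)
        (in-true (here refl)))
        where
        fold : ∀ {y} → y ∈ u ∷ t ∷ vs → y ∈ u ∷ vs
        fold (here p)          = here p
        fold (there (here p))  = here (trans p (sym u≡t))
        fold (there (there p)) = there p
        in-true : ∀ {y} → y ∈ u ∷ vs → mem (u ∷ vs) y ≡ true
        in-true {y} = dec-true (member? Fin._≟_ y (u ∷ vs))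
    euler (suc k) M@(m ∷ M′) u vs t len tr le with u Fin.≟ t
    ... | no u≢t = grab (oddness-witness (δ t) M odd)
      where
      open Trail tr
      odd : oddness (δ t) M ≡ true
      odd = flip (trans (sym (cong₂ (λ a b → (a xor b) xor oddness (δ t) M)
              (dec-false (u Fin.≟ t) u≢t) (dec-true (t Fin.≟ t) refl))) (even (δ t)))
        where
        flip : ∀ {b} → not b ≡ false → b ≡ true
        flip {true} _ = refl
      grab : ∃[ e ] e ∈ M × δ t (src e) xor δ t (tgt e) ≡ true → _
      grab (e , e∈ , p) with δ t (src e) in eq
      ... | true  = absorb k M e u vs t (tgt e) len tr le e∈ (inj₁ (sym (δ-true t eq) , refl))
      ... | false = absorb k M e u vs t (src e) len tr le e∈ (inj₂ (sym (δ-true t p) , refl))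
    ... | yes refl = grab (any? touches? M)
      where
      open Trail tr
      Touches : StreamItem n → Set
      Touches e = src e ∈ u ∷ vs ⊎ tgt e ∈ u ∷ vs
      touches? : ∀ e → Dec (Touches e)
      touches? e = member? Fin._≟_ (src e) (u ∷ vs) ⊎-dec member? Fin._≟_ (tgt e) (u ∷ vs)
      Goal = ∃[ v ] ∃[ ws ] (∀ x → x ∈ v ∷ ws) × walkWeight d v ws v ≤ walkWeight d u vs u + total M
      from : ∀ e z y → e ∈ M → z ∈ u ∷ vs → Ends e z y → Goal
      from e z y e∈ z∈ ends =
        let ws , tr′ , eq = trail-rotate tr z∈
            v , ws′ , all , bound = absorb k M e z ws z y len tr′ le e∈ ends
        in v , ws′ , all , subst (λ q → walkWeight d v ws′ v ≤ q + total M) eq bound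
      grab : Dec (Any Touches M) → Goal
      grab (yes touched) with find touched
      ... | e , e∈ , inj₁ s∈ = from e (src e) (tgt e) e∈ s∈ (inj₁ (refl , refl))
      ... | e , e∈ , inj₂ t∈ = from e (tgt e) (src e) e∈ t∈ (inj₂ (refl , refl))
      grab (no untouched) = contradiction
        (trans (sym (out {m} (inj₁ refl) (here refl)))
          (trans (connected (mem (u ∷ vs)) (λ y∈ → trans (in-true (fold y∈)) (sym (in-true (here refl))))
            (λ {e} e∈ → trans (out {e} (inj₁ refl) e∈) (sym (out {e} (inj₂ refl) e∈))) (src m))
            (in-true (here refl)))) λ ()
        where
        fold : ∀ {y} → y ∈ u ∷ u ∷ vs → y ∈ u ∷ vs
        fold (here p)  = here p
        fold (there p) = p
        in-true : ∀ {y} → y ∈ u ∷ vs → mem (u ∷ vs) y ≡ true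
        in-true {y} = dec-true (member? Fin._≟_ y (u ∷ vs))
        out : ∀ {e z} → z ≡ src e ⊎ z ≡ tgt e → e ∈ M → mem (u ∷ vs) z ≡ false
        out {e} {z} z≡ e∈ = dec-false (member? Fin._≟_ z (u ∷ vs)) (λ z∈ → untouched (lose e∈ (hit e z≡ z∈)))
          where
          hit : ∀ e {z} → z ≡ src e ⊎ z ≡ tgt e → z ∈ u ∷ vs → Touches e
          hit e (inj₁ refl) = inj₁
          hit e (inj₂ refl) = inj₂

  module _ (triangle : ∀ x y z → d x z ≤ d x y + d y z) where

    walkWeight-⊆ : ∀ {ws vs} → ws ⊆ vs → ∀ u r → walkWeight d u ws r ≤ walkWeight d u vs r
    walkWeight-⊆ []         u r = ℚ.≤-refl
    walkWeight-⊆ (_∷_ {y = v} refl s) u r = ℚ.+-monoʳ-≤ (d u v) (walkWeight-⊆ s v r)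
    walkWeight-⊆ {ws} (v ∷ʳ s) u r = ℚ.≤-trans (detour ws) (ℚ.+-monoʳ-≤ (d u v) (walkWeight-⊆ s v r))
      where
      detour : ∀ ws → walkWeight d u ws r ≤ d u v + walkWeight d v ws r
      detour []       = triangle u v r
      detour (x ∷ ws) = ℚ.≤-trans (ℚ.+-monoˡ-≤ (walkWeight d x ws r) (triangle u v x))
        (ℚ.≤-reflexive (ℚ.+-assoc (d u v) (d v x) (walkWeight d x ws r)))

    shortcut : ∀ u vs → (∀ x → x ∈ u ∷ vs) → ∃[ c ] cycleWeight d c ≤ walkWeight d u vs u
    shortcut u vs all =
      (deduplicate Fin._≟_ (u ∷ vs) ,
        Unique⇒↭allFin (Unique.deduplicate-! Fin._≟_ (u ∷ vs)) (λ x → ∈-deduplicate⁺ Fin._≟_ (all x))) ,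
      -- Deduplication keeps first occurrences, so the tour still begins and closes in `u`.
      walkWeight-⊆ (⊆-trans (filter-⊆ _ (deduplicate Fin._≟_ vs)) (dedup-⊆ vs)) u u
      where
      dedup-⊆ : ∀ (xs : List (Fin n)) → deduplicate Fin._≟_ xs ⊆ xs
      dedup-⊆ []       = []
      dedup-⊆ (x ∷ xs) = refl ∷ ⊆-trans (filter-⊆ _ (deduplicate Fin._≟_ xs)) (dedup-⊆ xs)

-- Shortest paths and shortest tours

minimum : {A : Set} (f : A → ℚ) (x : A) (xs : List A) → ∃[ m ] (∀ {y} → y ∈ x ∷ xs → f m ≤ f y)
minimum f x [] = x , λ { (here refl) → ℚ.≤-refl }
minimum f x (y ∷ xs) with minimum f y xs
... | m , least with f x ≤? f m
...   | yes x≤m = x , λ { (here refl) → ℚ.≤-refl ; (there y∈) → ℚ.≤-trans x≤m (least y∈) }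
...   | no  x≰m = m , λ { (here refl) → ℚ.<⇒≤ (ℚ.≰⇒> x≰m) ; (there y∈) → least y∈ }

finite-IsMinimumOf : {A : Set} (f : A → ℚ) (xs : List A) → A →
  (∀ a → ∃[ x ] x ∈ xs × f x ≤ f a) → ∃[ m ] IsMinimumOf f m
finite-IsMinimumOf f [] a dom with () ← proj₁ (proj₂ (dom a))
finite-IsMinimumOf f (x ∷ xs) _ dom =
  let m , least = minimum f x xs in
  f m , (m , refl) , λ a → let y , y∈ , y≤a = dom a in ℚ.≤-trans (least y∈) y≤a

module _ (G : WeightedGraph n) where

  infixr 5 _⊕_

  _⊕_ : ∀ {u v x} → Path G u v → Path G v x → Path G u x
  stop       ⊕ q = q
  step w e p ⊕ q = step w e (p ⊕ q)

  pathLength-⊕ : ∀ {u v x} (p : Path G u v) (q : Path G v x) → pathLength (p ⊕ q) ≡ pathLength p + pathLength q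
  pathLength-⊕ stop         q = sym (ℚ.+-identityˡ (pathLength q))
  pathLength-⊕ (step w e p) q =
    trans (cong (λ q → w + q) (pathLength-⊕ p q)) (sym (ℚ.+-assoc w (pathLength p) (pathLength q)))

  reversePath : ∀ {u v} (p : Path G u v) → ∃[ q ] pathLength {u = v} {u} q ≡ pathLength p
  reversePath stop = stop , refl
  reversePath (step {u} {v} w e p) =
    let q , eq = reversePath p in
    q ⊕ step w (trans (weight-sym G v u) e) stop ,
    (begin
      pathLength (q ⊕ step w _ stop) ≡⟨ pathLength-⊕ q _ ⟩
      pathLength q + (w + 0ℚ)        ≡⟨ cong₂ _+_ eq (ℚ.+-identityʳ w) ⟩
      pathLength p + w               ≡⟨ ℚ.+-comm (pathLength p) w ⟩
      w + pathLength p               ∎)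
    where open ≡-Reasoning

  pathLength-nonNeg : ∀ {u v} (p : Path G u v) → 0ℚ ≤ pathLength p
  pathLength-nonNeg stop         = ℚ.≤-refl
  pathLength-nonNeg (step w e p) = ℚ.+-mono-≤ (weight-nonNeg G _ _ w e) (pathLength-nonNeg p)

  vertices : ∀ {u v} → Path G u v → List (Fin n)
  vertices (stop {u})         = u ∷ []
  vertices (step {u} _ _ p) = u ∷ vertices p

  SimplePath≤ : Fin n → Fin n → ℚ → Set
  SimplePath≤ u v q = Σ[ p ∈ Path G u v ] Unique (vertices p) × pathLength p ≤ q

  suffix : ∀ {u v x} (p : Path G u v) → Unique (vertices p) → x ∈ vertices p → SimplePath≤ x v (pathLength p)
  suffix stop              uniq       (here refl) = stop , uniq , ℚ.≤-refl
  suffix p@(step _ _ _)    uniq       (here refl) = p , uniq , ℚ.≤-refl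
  suffix (step {u} w e p)  (_ ∷ uniq) (there x∈)  =
    let q , uniq′ , q≤p = suffix p uniq x∈ in
    q , uniq′ , ℚ.≤-trans q≤p (≤-from (weight-nonNeg G _ _ w e) (trans (ℚ.+-comm _ w) (sym (ℚ.+-identityˡ _))))

  eraseLoops : ∀ {u v} (p : Path G u v) → SimplePath≤ u v (pathLength p)
  eraseLoops stop = stop , [] ∷ [] , ℚ.≤-refl
  eraseLoops (step {u} w e p) with eraseLoops p
  ... | q , uniq , q≤p with member? Fin._≟_ u (vertices q)
  ...   | no u∉ = step w e q , All.¬Any⇒All¬ _ u∉ ∷ uniq , ℚ.+-monoʳ-≤ w q≤p
  ...   | yes u∈ =
    let r , uniq′ , r≤q = suffix q uniq u∈ in
    r , uniq′ , ℚ.≤-trans r≤q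
      (≤-from (ℚ.+-mono-≤ q≤p (weight-nonNeg G _ _ w e)) (rearrange (pathLength q) (pathLength p) w))
    where
    rearrange : ∀ q p w → q + (p + w) ≡ (q + 0ℚ) + (w + p)
    rearrange = solve 3 (λ q p w → q :+ (p :+ w) := (q :+ con 0ℚ) :+ (w :+ p)) refl
      where open +-*-Solver

  prepend : ∀ {u x v} → List (Path G x v) → (m : Maybe ℚ) → weight G u x ≡ m → List (Path G u v)
  prepend ps nothing  _  = []
  prepend ps (just w) eq = map (step w eq) ps

  -- All paths with at most k vertices, both ends included.
  paths : ℕ → (u v : Fin n) → List (Path G u v)
  paths zero    u v = []
  paths (suc k) u v = trivial (u Fin.≟ v) ++ concatMap (λ x → prepend (paths k x v) (weight G u x) refl) (allFin n)
    where
    trivial : Dec (u ≡ v) → List (Path G u v)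
    trivial (yes refl) = stop ∷ []
    trivial (no _)     = []

  ∈-prepend : ∀ {u x v w} {ps : List (Path G x v)} {q} m eq → m ≡ just w → q ∈ ps →
    ∃[ r ] r ∈ prepend {u} ps m eq × pathLength r ≡ w + pathLength q
  ∈-prepend {q = q} (just w) eq refl q∈ = step w eq q , ∈-map⁺ (step w eq) q∈ , refl

  paths-complete : ∀ k {u v} (p : Path G u v) → length (vertices p) ℕ.≤ k →
    ∃[ q ] q ∈ paths k u v × pathLength q ≡ pathLength p
  paths-complete (suc k) (stop {u}) _ with u Fin.≟ u
  ... | yes refl = stop , here refl , refl
  ... | no ¬p    = contradiction refl ¬p
  paths-complete (suc k) {u} {v} (step {v = x} w e p) (ℕ.s≤s len) =
    let q , q∈ , q≡ = paths-complete k p len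
        r , r∈ , r≡ = ∈-prepend (weight G u x) refl e q∈
    in r , ∈-++⁺ʳ _ (∈-concatMap⁺ (λ y → prepend (paths k y v) (weight G u y) refl) (lose (∈-allFin x) r∈)) ,
       trans r≡ (cong (λ q → w + q) q≡)

  -- Erasing loops does not lengthen a path, and a loopless path has at most `n` vertices; so the
  -- finite list `paths n u v` undercuts the infinitely many paths.
  shortestPathMetric : Connected G → ∃[ d ] IsShortestPathMetric G d
  shortestPathMetric (_ , conn) = (λ u v → proj₁ (least u v)) , (λ u v → proj₂ (least u v))
    where
    least : ∀ u v → ∃[ m ] IsMinimumOf (pathLength {G = G} {u} {v}) m
    least u v = finite-IsMinimumOf pathLength (paths n u v) (conn u v) λ p →
      let q , uniq , q≤p = eraseLoops p
          r , r∈ , r≡q   = paths-complete n q (length-Unique uniq)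
      in r , r∈ , ℚ.≤-trans (ℚ.≤-reflexive r≡q) q≤p

  module _ {d : Fin n → Fin n → ℚ} (isMetric : IsShortestPathMetric G d) where

    d-least : ∀ {u v} (p : Path G u v) → d u v ≤ pathLength p
    d-least = proj₂ (isMetric _ _)

    shortest : ∀ u v → Path G u v
    shortest u v = proj₁ (proj₁ (isMetric u v))

    shortest-length : ∀ u v → pathLength (shortest u v) ≡ d u v
    shortest-length u v = proj₂ (proj₁ (isMetric u v))

    d-refl : ∀ u → d u u ≡ 0ℚ
    d-refl u = ℚ.≤-antisym (d-least stop) (subst (0ℚ ≤_) (shortest-length u u) (pathLength-nonNeg (shortest u u)))

    d-sym : ∀ u v → d u v ≡ d v u
    d-sym u v = ℚ.≤-antisym (half u v) (half v u)
      where
      half : ∀ u v → d u v ≤ d v u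
      half u v = let q , eq = reversePath (shortest v u) in
        ℚ.≤-trans (d-least q) (ℚ.≤-reflexive (trans eq (shortest-length v u)))

    d-triangle : ∀ x y z → d x z ≤ d x y + d y z
    d-triangle x y z = ℚ.≤-trans (d-least (shortest x y ⊕ shortest y z))
      (ℚ.≤-reflexive (trans (pathLength-⊕ (shortest x y) (shortest y z))
        (cong₂ _+_ (shortest-length x y) (shortest-length y z))))

    d-edge : ∀ {u v w} → weight G u v ≡ just w → d u v ≤ w
    d-edge {w = w} e = ℚ.≤-trans (d-least (step w e stop)) (ℚ.≤-reflexive (ℚ.+-identityʳ w))

lists : ∀ n → ℕ → List (List (Fin n))
lists n zero    = [] ∷ []
lists n (suc k) = concatMap (λ x → map (x ∷_) (lists n k)) (allFin n)

∈-lists : ∀ (xs : List (Fin n)) → xs ∈ lists n (length xs)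
∈-lists     []       = here refl
∈-lists {n} (x ∷ xs) = ∈-concatMap⁺ (λ y → map (y ∷_) (lists n (length xs)))
  (lose (∈-allFin x) (∈-map⁺ (x ∷_) (∈-lists xs)))

IsTour : List (Fin n) → Set
IsTour vs = Unique vs × (∀ x → x ∈ vs)

isTour? : (vs : List (Fin n)) → Dec (IsTour vs)
isTour? vs = Unique.unique? Fin._≟_ vs ×-dec all? (λ x → member? Fin._≟_ x vs)

↭allFin⇒IsTour : {vs : List (Fin n)} → vs ↭ allFin n → IsTour vs
↭allFin⇒IsTour {n} perm =
  Permutationₛ.Unique-resp-↭ (setoid (Fin n)) (↭⇒↭ₛ (↭-sym perm)) (allFin⁺ n) ,
  λ x → ∈-resp-↭ (↭-sym perm) (∈-allFin x)

toCycles : (vs : List (Fin n)) → Dec (IsTour vs) → List (HamiltonianCycle n)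
toCycles vs (yes (uniq , all)) = (vs , Unique⇒↭allFin uniq all) ∷ []
toCycles vs (no _)             = []

∈-toCycles : ∀ (vs : List (Fin n)) → IsTour vs → ∀ tour? → ∃[ c ] c ∈ toCycles vs tour? × proj₁ c ≡ vs
∈-toCycles vs _    (yes _)  = _ , here refl , refl
∈-toCycles vs tour (no ¬t)  = contradiction tour ¬t

-- The weight of a tour depends on its list and not on its permutation proof, so one cycle for each
-- list in a finite enumeration is enough.
shortestTour : (d : Fin n → Fin n → ℚ) → ∃[ t ] IsMinimumOf (cycleWeight d) t
shortestTour {n} d = finite-IsMinimumOf (cycleWeight d)
  (concatMap (λ vs → toCycles vs (isTour? vs)) (lists n n)) (allFin n , ↭-refl) λ (vs , perm) →
    let len = trans (↭-length perm) (length-tabulate {n = n} id)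
        c , c∈ , eq = ∈-toCycles vs (↭allFin⇒IsTour perm) (isTour? vs)
    in c , ∈-concatMap⁺ (λ vs → toCycles vs (isTour? vs)) (lose (subst (λ k → vs ∈ lists n k) len (∈-lists vs)) c∈) ,
       ℚ.≤-reflexive (cong (closedWalkWeight d) eq)

-- The two bounds

select : List (StreamItem n) → (ℕ → Bool) → List (StreamItem n)
select []      g = []
select (f ∷ T) g = if g 0 then f ∷ select T (g ∘ suc) else select T (g ∘ suc)

∈-select⁻ : ∀ (T : List (StreamItem n)) g {e} → e ∈ select T g → e ∈ T
∈-select⁻ (f ∷ T) g e∈ with g 0 | e∈
... | true  | here p   = here p
... | true  | there e∈ = there (∈-select⁻ T (g ∘ suc) e∈)
... | false | e∈       = there (∈-select⁻ T (g ∘ suc) e∈)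

total-select : ∀ (T : List (StreamItem n)) g → total (select T g) ≡ mass T g
total-select []      g = refl
total-select (f ∷ T) g with g 0
... | true  = cong₂ _+_ (sym (ℚ.*-identityˡ (wt f))) (total-select T (g ∘ suc))
... | false = trans (total-select T (g ∘ suc))
  (sym (trans (cong (_+ mass T (g ∘ suc)) (ℚ.*-zeroˡ (wt f))) (ℚ.+-identityˡ _)))

mass-not : ∀ (T : List (StreamItem n)) g → mass T g + mass T (not ∘ g) ≡ total T
mass-not T g = trans (sym (wsum-+ T (𝟙 ∘ g) (𝟙 ∘ not ∘ g)))
  (trans (wsum-cong T (λ i _ → compl (g i))) (wsum-1 T))
  where
  compl : ∀ b → 𝟙 b + 𝟙 (not b) ≡ 1ℚ
  compl true  = refl
  compl false = refl

total-++ : ∀ (A B : List (StreamItem n)) → total (A ++ B) ≡ total A + total B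
total-++ []      B = sym (ℚ.+-identityˡ (total B))
total-++ (e ∷ A) B = trans (cong (λ q → wt e + q) (total-++ A B)) (sym (ℚ.+-assoc (wt e) (total A) (total B)))

-- Each edge of `J` has the same ends as its tree path, and both sides are sums over 𝔽₂. So the tree
-- edges in `parity T J` and the edges of `J` together have even degrees.
boundary-parity : ∀ {T : List (StreamItem n)} → Forest T → ∀ J → (∀ {e} → e ∈ J → Spans T e) → ∀ σ →
  boundary T (parity T J) σ ≡ oddness σ J
boundary-parity {T = T} F [] _ σ = none T
  where
  none : ∀ T → boundary T (λ _ → false) σ ≡ false
  none []      = refl
  none (_ ∷ T) = none T
boundary-parity {T = T} F (e ∷ J) sp σ = trans (boundary-xor T (cov T e) (parity T J) σ)
  (cong₂ _xor_ (boundary-cov F e (sp (here refl)) σ) (boundary-parity F J (sp ∘ there) σ))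

-- Edges outside `g` are counted twice and cancel.
oddness-select : ∀ (T : List (StreamItem n)) g σ →
  oddness σ T xor oddness σ (select T (not ∘ g)) ≡ boundary T g σ
oddness-select []      g σ = refl
oddness-select (f ∷ T) g σ with g 0
... | true  = trans (Bool.xor-assoc (σ (src f) xor σ (tgt f)) (oddness σ T) _)
  (cong ((σ (src f) xor σ (tgt f)) xor_) (oddness-select T (g ∘ suc) σ))
... | false = trans (twice (σ (src f) xor σ (tgt f)) (oddness σ T) _) (oddness-select T (g ∘ suc) σ)
  where
  twice : ∀ a b c → (a xor b) xor (a xor c) ≡ b xor c
  twice = solve 3 (λ a b c → (a :+ b) :+ (a :+ c) := b :+ c) refl
    where open xor-∧-Solver

estimate : List (StreamItem n) → (ℕ → Bool) → ℚ
estimate T C = total T + total T - (+ 1 / 6) * mass T C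

upper-bound : ∀ {T seen : List (StreamItem n)} {C d} → Fin n → Forest T → (∀ x y → Joined T x y) →
  (∀ {e} → e ∈ T → e ∈ seen) → IsCover T seen C →
  (∀ x → d x x ≡ 0ℚ) → (∀ x y → d x y ≡ d y x) → (∀ x y z → d x z ≤ d x y + d y z) →
  (∀ {e} → e ∈ seen → d (src e) (tgt e) ≤ wt e) →
  ∃[ c ] cycleWeight d c ≤ estimate T C
upper-bound {T = T} {seen} {C} {d} v₀ F spanning T⊆seen K d-refl d-sym triangle d-edge
  with halving T (IsCover.cover K) (λ _ → false)
... | J , J⊆E , half =
  let v , ws , all , walk≤ = euler d d-sym (length M) M v₀ [] v₀ refl trail le
      c , c≤ = shortcut d triangle v ws all
  -- The walk weighs `2 total T − mass T par + total J`. Half of `half` bounds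
  -- `total J − mass T par` by `(total cover − mass T C) / 2`, and a sixth of `cheap` bounds that by
  -- `− mass T C / 6`.
  in c , ≤-from (ℚ.+-mono-≤ (ℚ.+-mono-≤ (ℚ.≤-trans c≤ (ℚ.≤-trans walk≤ (ℚ.≤-reflexive M≡)))
                   (ℚ.*-monoˡ-≤-nonNeg (+ 1 / 2) half))
                   (ℚ.*-monoˡ-≤-nonNeg (+ 1 / 6) cheap))
           (final (cycleWeight d c))
  where
  open IsCover K
  par = parity T J
  M = T ++ (select T (not ∘ par) ++ J)
  trail : Trail M v₀ [] v₀
  trail = record
    { even = λ σ → trans (cong (_xor oddness σ M) (Bool.xor-same (σ v₀))) (begin
        oddness σ M
          ≡⟨ trans (oddness-++ σ T _) (cong (oddness σ T xor_) (oddness-++ σ (select T (not ∘ par)) J)) ⟩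
        oddness σ T xor (oddness σ (select T (not ∘ par)) xor oddness σ J)
          ≡⟨ Bool.xor-assoc (oddness σ T) _ _ ⟨
        (oddness σ T xor oddness σ (select T (not ∘ par))) xor oddness σ J
          ≡⟨ cong (_xor oddness σ J) (trans (oddness-select T par σ) (boundary-parity F J (λ _ → spanning _ _) σ)) ⟩
        oddness σ J xor oddness σ J
          ≡⟨ Bool.xor-same (oddness σ J) ⟩
        false ∎)
    ; connected = λ σ _ edges x → joined-universal σ T (edges ∘ ∈-++⁺ˡ) (spanning x v₀)
    }
    where open ≡-Reasoning
  le : ∀ {e} → e ∈ M → d (src e) (tgt e) ≤ wt e
  le e∈ with ∈-++⁻ T e∈
  ... | inj₁ e∈T = d-edge (T⊆seen e∈T)
  ... | inj₂ e∈′ with ∈-++⁻ (select T (not ∘ par)) e∈′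
  ...   | inj₁ e∈S = d-edge (T⊆seen (∈-select⁻ T (not ∘ par) e∈S))
  ...   | inj₂ e∈J = d-edge (subset (J⊆E e∈J))
  M≡ : d v₀ v₀ + total M ≡ total T + (mass T (not ∘ par) + total J)
  M≡ = trans (cong (_+ total M) (d-refl v₀)) (trans (ℚ.+-identityˡ (total M)) (trans (total-++ T _)
    (cong (λ q → total T + q) (trans (total-++ (select T (not ∘ par)) J)
      (cong (_+ total J) (total-select T (not ∘ par)))))))
  half≡ : wsum T (λ i → twiceOdd (covers T cover i) false) ≡ mass T C
  half≡ = wsum-cong T (λ i i< → trans (flat (covers T cover i)) (cong 𝟙 (sym (covered i i<))))
    where
    flat : ∀ b → twiceOdd b false ≡ 𝟙 b
    flat true  = refl
    flat false = refl
  identity : ∀ W m m′ j k c → W + (((m + m′) + (m′ + j)) + (+ 1 / 2) * (m + m + k) + (+ 1 / 6) * (c + c))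
    ≡ (W + (+ 1 / 2) * (c + (j + j)) + (+ 1 / 6) * (k + k + k)) + ((m + m′) + (m + m′) - (+ 1 / 6) * c)
  identity = solve 6 (λ W m m′ j k c →
      W :+ (((m :+ m′) :+ (m′ :+ j)) :+ con (+ 1 / 2) :* (m :+ m :+ k) :+ con (+ 1 / 6) :* (c :+ c))
    := (W :+ con (+ 1 / 2) :* (c :+ (j :+ j)) :+ con (+ 1 / 6) :* (k :+ k :+ k))
       :+ ((m :+ m′) :+ (m :+ m′) :- con (+ 1 / 6) :* c)) refl
    where open +-*-Solver
  Certificate : (W t h : ℚ) → Set
  Certificate W t h =
    W + ((t + (mass T (not ∘ par) + total J)) + (+ 1 / 2) * (mass T par + mass T par + total cover)
           + (+ 1 / 6) * (mass T C + mass T C))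
    ≡ (W + (+ 1 / 2) * (h + (total J + total J)) + (+ 1 / 6) * (total cover + total cover + total cover))
      + (t + t - (+ 1 / 6) * mass T C)
  final : ∀ W → Certificate W (total T) (wsum T (λ i → twiceOdd (covers T cover i) false))
  final W = subst₂ (Certificate W)
    (mass-not T par) (sym half≡)
    (identity W (mass T par) (mass T (not ∘ par)) (total J) (total cover) (mass T C))

-- Crossings of a tour

0≤𝟙 : ∀ b → 0ℚ ≤ 𝟙 b
0≤𝟙 true  = ℚ.nonNegative⁻¹ 1ℚ
0≤𝟙 false = ℚ.≤-refl

crossings-nonNeg : ∀ σ (S : List (StreamItem n)) → 0ℚ ≤ crossings σ S
crossings-nonNeg σ []      = ℚ.≤-refl
crossings-nonNeg σ (e ∷ S) = ℚ.+-mono-≤ (0≤𝟙 (σ (src e) xor σ (tgt e))) (crossings-nonNeg σ S)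

crossings-++ : ∀ σ (A B : List (StreamItem n)) → crossings σ (A ++ B) ≡ crossings σ A + crossings σ B
crossings-++ σ []      B = sym (ℚ.+-identityˡ _)
crossings-++ σ (e ∷ A) B = trans (cong (λ q → k + q) (crossings-++ σ A B))
  (sym (ℚ.+-assoc k (crossings σ A) (crossings σ B)))
  where k = 𝟙 (σ (src e) xor σ (tgt e))

module _ {G : WeightedGraph n} where

  pathEdges : ∀ {u v} → Path G u v → List (StreamItem n)
  pathEdges stop                 = []
  pathEdges (step {u} {v} w _ p) = (u , v , w) ∷ pathEdges p

  total-pathEdges : ∀ {u v} (p : Path G u v) → total (pathEdges p) ≡ pathLength p
  total-pathEdges stop         = refl
  total-pathEdges (step w _ p) = cong (λ q → w + q) (total-pathEdges p)

  ∈-pathEdges : ∀ {u v} (p : Path G u v) {e} → e ∈ pathEdges p → weight G (src e) (tgt e) ≡ just (wt e)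
  ∈-pathEdges (step w eq p) (here refl) = eq
  ∈-pathEdges (step w eq p) (there e∈)  = ∈-pathEdges p e∈

  joined-path : ∀ {L u v} (p : Path G u v) → (∀ {e} → e ∈ pathEdges p → Spans L e) → Joined L u v
  joined-path stop         _  = joined-refl
  joined-path (step w _ p) sp = joined-trans (sp (here refl)) (joined-path p (sp ∘ there))

  crossings-path : ∀ σ {u v} (p : Path G u v) → σ u ≢ σ v → 1ℚ ≤ crossings σ (pathEdges p)
  crossings-path σ stop u≢v = contradiction refl u≢v
  crossings-path σ (step {u} {x} w _ p) u≢v with σ u Bool.≟ σ x
  ... | yes u≡x = ℚ.≤-trans (crossings-path σ p (λ x≡v → u≢v (trans u≡x x≡v)))
    (≤-from (0≤𝟙 (σ u xor σ x)) (trans (ℚ.+-comm (crossings σ (pathEdges p)) _) (sym (ℚ.+-identityˡ _))))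
  ... | no  u≢x = subst (λ b → 1ℚ ≤ 𝟙 b + crossings σ (pathEdges p)) (sym (≢⇒xor (σ u) (σ x) u≢x))
    (ℚ.+-monoʳ-≤ 1ℚ (crossings-nonNeg σ (pathEdges p)))
    where
    ≢⇒xor : ∀ a b → a ≢ b → a xor b ≡ true
    ≢⇒xor true  true  ne = contradiction refl ne
    ≢⇒xor true  false _  = refl
    ≢⇒xor false true  _  = refl
    ≢⇒xor false false ne = contradiction refl ne

  module _ {d : Fin n → Fin n → ℚ} (isMetric : IsShortestPathMetric G d) where

    legEdges : Fin n → Fin n → List (StreamItem n)
    legEdges u v = pathEdges (shortest G isMetric u v)

    tourEdges : Fin n → List (Fin n) → Fin n → List (StreamItem n)
    tourEdges u []       r = legEdges u r
    tourEdges u (v ∷ vs) r = legEdges u v ++ tourEdges v vs r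

    total-tourEdges : ∀ u vs r → total (tourEdges u vs r) ≡ walkWeight d u vs r
    total-tourEdges u []       r = trans (total-pathEdges (shortest G isMetric u r)) (shortest-length G isMetric u r)
    total-tourEdges u (v ∷ vs) r = trans (total-++ (legEdges u v) _)
      (cong₂ _+_ (total-tourEdges u [] v) (total-tourEdges v vs r))

    ∈-tourEdges : ∀ u vs r {e} → e ∈ tourEdges u vs r → weight G (src e) (tgt e) ≡ just (wt e)
    ∈-tourEdges u []       r e∈ = ∈-pathEdges (shortest G isMetric u r) e∈
    ∈-tourEdges u (v ∷ vs) r e∈ with ∈-++⁻ (legEdges u v) e∈
    ... | inj₁ e∈ = ∈-pathEdges (shortest G isMetric u v) e∈
    ... | inj₂ e∈ = ∈-tourEdges v vs r e∈

    joined-tour : ∀ {L} u vs r → (∀ {e} → e ∈ tourEdges u vs r → Spans L e) → ∀ {z} → z ∈ u ∷ vs → Joined L u z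
    joined-tour u vs       r sp (here refl) = joined-refl
    joined-tour u (v ∷ vs) r sp (there z∈)  = joined-trans
      (joined-path (shortest G isMetric u v) (sp ∘ ∈-++⁺ˡ))
      (joined-tour v vs r (sp ∘ ∈-++⁺ʳ (legEdges u v)) z∈)

    crossings-open : ∀ σ u vs r → σ u ≢ σ r → 1ℚ ≤ crossings σ (tourEdges u vs r)
    crossings-open σ u []       r u≢r = crossings-path σ (shortest G isMetric u r) u≢r
    crossings-open σ u (v ∷ vs) r u≢r with σ u Bool.≟ σ v
    ... | yes u≡v = subst (1ℚ ≤_) (sym (crossings-++ σ (legEdges u v) _))
      (ℚ.+-mono-≤ (crossings-nonNeg σ (legEdges u v)) (crossings-open σ v vs r (λ v≡r → u≢r (trans u≡v v≡r))))
    ... | no  u≢v = subst (1ℚ ≤_) (sym (crossings-++ σ (legEdges u v) _))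
      (ℚ.+-mono-≤ (crossings-path σ (shortest G isMetric u v) u≢v) (crossings-nonNeg σ (tourEdges v vs r)))

    -- The first leg that changes sides crosses once, and the rest of the tour has to come back to
    -- the side of `r`. Only the sides of `u` and `r` must agree, so that the induction can advance
    -- `u`.
    crossings-closed : ∀ σ u vs r {z} → σ u ≡ σ r → z ∈ vs → σ u ≢ σ z → 1ℚ + 1ℚ ≤ crossings σ (tourEdges u vs r)
    crossings-closed σ u (v ∷ vs) r u≡r z∈ u≢z with σ u Bool.≟ σ v | z∈
    ... | no u≢v | _ = subst (1ℚ + 1ℚ ≤_) (sym (crossings-++ σ (legEdges u v) _))
      (ℚ.+-mono-≤ (crossings-path σ (shortest G isMetric u v) u≢v)
        (crossings-open σ v vs r (λ v≡r → u≢v (trans u≡r (sym v≡r)))))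
    ... | yes u≡v | here refl = contradiction u≡v u≢z
    ... | yes u≡v | there z∈′ = subst (1ℚ + 1ℚ ≤_) (sym (crossings-++ σ (legEdges u v) _))
      (ℚ.+-mono-≤ (crossings-nonNeg σ (legEdges u v))
        (crossings-closed σ v vs r (trans (sym u≡v) u≡r) z∈′ (λ v≡z → u≢z (trans u≡v v≡z))))

flip : StreamItem n → StreamItem n
flip (u , v , w) = (v , u , w)

gain-flip : ∀ (T : List (StreamItem n)) C e → gain T C (flip e) ≡ gain T C e
gain-flip T C e = wsum-cong T (λ i _ →
  cong (λ b → 𝟙 (b ∧ not (C i))) (Bool.xor-comm (cut T i (tgt e)) (cut T i (src e))))

module _ {G : WeightedGraph n} {s : List (StreamItem n)} (stream : IsGraphStream G s) where

  open IsGraphStream stream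

  stream-nonNeg : NonNegWeights s
  stream-nonNeg e∈ = weight-nonNeg G _ _ _ (sound e∈)

  -- The stream shows an edge in one orientation, while paths may run through it in either.
  everyEdge : (P : StreamItem n → Set) → (∀ e → P (flip e) → P e) → (∀ {e} → e ∈ s → P e) →
    ∀ {e} → weight G (src e) (tgt e) ≡ just (wt e) → P e
  everyEdge P P-flip all {e} eq = [ all , (λ e∈ → P-flip e (all e∈)) ]′ (complete eq)

  module _ {T : List (StreamItem n)} (msf : IsMSF s T) where

    open IsMSF msf

    edge-Light : ∀ {e} → weight G (src e) (tgt e) ≡ just (wt e) → Light T e
    edge-Light = everyEdge (Light T) (λ _ → joined-sym) light

    spanning : Connected G → ∀ x y → Joined T x y
    spanning (_ , conn) x y = joined-path (conn x y)
      (λ {e} e∈ → light⇒spans {T = T} {e} (edge-Light (∈-pathEdges (conn x y) e∈)))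

    lower-bound : ∀ {C d} → IsCover T s C → IsShortestPathMetric G d → ∀ c → Fin n →
      estimate T C ≤ (+ 196 / 100) * cycleWeight d c
    lower-bound K isMetric ([] , perm) v with () ← ∈-resp-↭ (↭-sym perm) (∈-allFin v)
    lower-bound {C} {d} K isMetric (v₀ ∷ vs , perm) _ =
      subst₂ (λ t q → t + t - (+ 1 / 6) * mass T C ≤ (+ 196 / 100) * q)
        (mass-not T C) total≡
        -- With c and r the covered and uncovered weight, the estimate is 11/6 · (c + r) + 1/24 ·
        -- 4r, hence at most 11/6 + 3/24 = 47/24 times `total S`. The slack is 1.96 - 47/24 = 1/600.
        (≤-from (ℚ.+-mono-≤ (ℚ.+-mono-≤ (ℚ.*-monoˡ-≤-nonNeg (+ 11 / 6) (subst (_≤ total S) (sym (mass-not T C)) T≤S))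
                                         (ℚ.*-monoˡ-≤-nonNeg (+ 1 / 24) rest≤))
                             (ℚ.*-monoˡ-≤-nonNeg (+ 1 / 600) (total-nonNeg S-nonNeg)))
          (identity (mass T C) (mass T (not ∘ C)) (total S)))
      where
      S = tourEdges isMetric v₀ vs v₀
      S-edge : ∀ {e} → e ∈ S → weight G (src e) (tgt e) ≡ just (wt e)
      S-edge = ∈-tourEdges isMetric v₀ vs v₀
      S-nonNeg : NonNegWeights S
      S-nonNeg e∈ = weight-nonNeg G _ _ _ (S-edge e∈)
      total≡ : total S ≡ walkWeight d v₀ vs v₀
      total≡ = total-tourEdges isMetric v₀ vs v₀
      visited : ∀ x → x ∈ v₀ ∷ vs
      visited x = ∈-resp-↭ (↭-sym perm) (∈-allFin x)
      S-spanning : ∀ x y → Joined S x y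
      S-spanning x y = joined-trans (joined-sym (reach x)) (reach y)
        where
        reach : ∀ z → Joined S v₀ z
        reach z = joined-tour isMetric v₀ vs v₀ spans-∈ (visited z)
      T≤S : total T ≤ total S
      T≤S = msf-minimal msf (λ e∈ → S-nonNeg e∈ , edge-Light (S-edge e∈)) S-spanning
      twice : ∀ i → i ℕ.< length T → 1ℚ + 1ℚ ≤ crossings (cut T i) S
      twice i i< with cut-separates forest i i<
      -- One of `x` and `y` lies on the side away from `v₀`, and the tour visits it.
      ... | x , y , _ , x≢y with cut T i v₀ Bool.≟ cut T i x
      ...   | no  v≢x = cross x v≢x
        where
        cross : ∀ z → cut T i v₀ ≢ cut T i z → 1ℚ + 1ℚ ≤ crossings (cut T i) S
        cross z v≢z with visited z
        ... | here refl = contradiction refl v≢z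
        ... | there z∈  = crossings-closed isMetric (cut T i) v₀ vs v₀ refl z∈ v≢z
      ...   | yes v≡x with visited y
      ...     | here refl = contradiction (sym v≡x) x≢y
      ...     | there y∈  = crossings-closed isMetric (cut T i) v₀ vs v₀ refl y∈ (λ v≡y → x≢y (trans (sym v≡x) v≡y))
      rest = mass T (not ∘ C)
      rest≤ : (rest + rest) + (rest + rest) ≤ total S + total S + total S
      rest≤ = uncovered-bound (stream-nonNeg ∘ subset) S twice
        (λ e∈ → everyEdge (λ e → gain T C e + gain T C e ≤ wt e + wt e + wt e)
          (λ e → subst (λ g → g + g ≤ wt e + wt e + wt e) (gain-flip T C e)) (IsCover.exhaustive K) (S-edge e∈))
      identity : ∀ c r q → ((c + r) + (c + r) - (+ 1 / 6) * c)
          + ((+ 11 / 6) * q + (+ 1 / 24) * (q + q + q) + (+ 1 / 600) * q)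
        ≡ ((+ 11 / 6) * (c + r) + (+ 1 / 24) * ((r + r) + (r + r)) + (+ 1 / 600) * 0ℚ) + (+ 196 / 100) * q
      identity = solve 3 (λ c r q → ((c :+ r) :+ (c :+ r) :- con (+ 1 / 6) :* c)
          :+ (con (+ 11 / 6) :* q :+ con (+ 1 / 24) :* (q :+ q :+ q) :+ con (+ 1 / 600) :* q)
        := (con (+ 11 / 6) :* (c :+ r) :+ con (+ 1 / 24) :* ((r :+ r) :+ (r :+ r)) :+ con (+ 1 / 600) :* con 0ℚ)
           :+ con (+ 196 / 100) :* q) refl
        where open +-*-Solver

-- Memory

toBits : ∀ k → ℕ → Vec Bool k
toBits zero    m = []
toBits (suc k) m with 2 ^ k ℕ.≤? m
... | yes _ = true  ∷ toBits k (m ∸ 2 ^ k)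
... | no  _ = false ∷ toBits k m

fromBits : ∀ {k} → Vec Bool k → ℕ
fromBits         []           = 0
fromBits {suc k} (true  ∷ bs) = 2 ^ k ℕ.+ fromBits bs
fromBits         (false ∷ bs) = fromBits bs

fromBits-toBits : ∀ k {m} → m ℕ.< 2 ^ k → fromBits (toBits k m) ≡ m
fromBits-toBits zero    (ℕ.s<s ℕ.z≤n) = refl
fromBits-toBits (suc k) {m} m< with 2 ^ k ℕ.≤? m
... | no  ≰m = fromBits-toBits k (ℕ.≰⇒> ≰m)
... | yes ≤m = trans (cong (2 ^ k ℕ.+_) (fromBits-toBits k m∸<)) (ℕ.m+[n∸m]≡n ≤m)
  where
  m∸< : m ∸ 2 ^ k ℕ.< 2 ^ k
  m∸< = ℕ.+-cancelˡ-< (2 ^ k) _ _ (subst₂ ℕ._<_ (sym (ℕ.m+[n∸m]≡n ≤m)) (cong (2 ^ k ℕ.+_) (ℕ.+-identityʳ (2 ^ k))) m<)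

n<2^bitLength : ∀ n → n ℕ.< 2 ^ bitLength n
n<2^bitLength n = ℕ.≰⇒> λ 2^≤n →
  ℕ.<-irrefl refl (subst (ℕ._≤ ⌊log₂ n ⌋) (⌊log₂[2^n]⌋≡n (bitLength n)) (⌊log₂⌋-mono-≤ 2^≤n))

-- A row of six numbers per slot: presence, the two end vertices, numerator and
-- denominator of the weight, and the covered flag.
flag : Bool → ℕ
flag true  = 1
flag false = 0

unflag : ℕ → Bool
unflag zero    = false
unflag (suc _) = true

toRows : ∀ {m} → List (StreamItem n) → Vec Bool m → Vec ℕ (m ℕ.* 6)
toRows     L                 []       = []
toRows {n} []                (c ∷ cs) = 0 ∷ 0 ∷ 0 ∷ 0 ∷ 0 ∷ flag c ∷ toRows {n} [] cs
toRows     ((u , v , w) ∷ L) (c ∷ cs) = 1 ∷ toℕ u ∷ toℕ v ∷ ∣ ↥ w ∣ ∷ ↧ₙ w ∷ flag c ∷ toRows L cs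

-- Weights are nonnegative, so the numerator is stored without a sign. Rows that encode no item
-- decode to the empty list.
fromRow : ∀ n → (p u v a q : ℕ) → List (StreamItem n)
fromRow n zero    u v a q       = []
fromRow n (suc _) u v a zero    = []
fromRow n (suc _) u v a (suc q) with u ℕ.<? n | v ℕ.<? n
... | yes u< | yes v< = (fromℕ< u< , fromℕ< v< , + a / suc q) ∷ []
... | _      | _      = []

fromRows : ∀ m → Vec ℕ (m ℕ.* 6) → List (StreamItem n) × Vec Bool m
fromRows         zero    []                             = [] , []
fromRows {n = n} (suc m) (p ∷ u ∷ v ∷ a ∷ q ∷ c ∷ rows) =
  let L , cs = fromRows m rows in fromRow n p u v a q ++ L , unflag c ∷ cs

unflag-flag : ∀ c → unflag (flag c) ≡ c
unflag-flag true  = refl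
unflag-flag false = refl

Valid : ℕ → StreamItem n → Set
Valid b e = HasBitSize b (wt e) × 0ℚ ≤ wt e

+∣↥∣≡↥ : ∀ {w} → 0ℚ ≤ w → + ∣ ↥ w ∣ ≡ ↥ w
+∣↥∣≡↥ {mkℚ (+ _) _ _}     _   = refl
+∣↥∣≡↥ {mkℚ -[1+ _ ] _ _} (*≤* ())

fromRow-item : ∀ (u v : Fin n) w → 0ℚ ≤ w → fromRow n 1 (toℕ u) (toℕ v) ∣ ↥ w ∣ (↧ₙ w) ≡ (u , v , w) ∷ []
fromRow-item {n} u v w 0≤w with toℕ u ℕ.<? n | toℕ v ℕ.<? n
... | yes u< | yes v< = cong (_∷ []) (cong₂ _,_ (fromℕ<-toℕ u u<) (cong₂ _,_ (fromℕ<-toℕ v v<)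
  (trans (cong (_/ ↧ₙ w) (+∣↥∣≡↥ 0≤w)) (ℚ.↥p/↧p≡p w))))
... | no u≮ | _       = contradiction (toℕ<n u) u≮
... | yes _  | no v≮  = contradiction (toℕ<n v) v≮

fromRows-toRows : ∀ {m} (L : List (StreamItem n)) (cs : Vec Bool m) → length L ℕ.≤ m → NonNegWeights L →
  fromRows m (toRows L cs) ≡ (L , cs)
fromRows-toRows     []      []       _          _   = refl
fromRows-toRows {n} []      (c ∷ cs) _          pos = cong₂ (λ r c → proj₁ r , c ∷ proj₂ r)
  (fromRows-toRows {n} [] cs ℕ.z≤n (λ ())) (unflag-flag c)
fromRows-toRows (e@(u , v , w) ∷ L) (c ∷ cs) (ℕ.s≤s len) pos = trans
  (cong₂ (λ r c → fromRow _ 1 (toℕ u) (toℕ v) ∣ ↥ w ∣ (↧ₙ w) ++ proj₁ r , c ∷ proj₂ r)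
    (fromRows-toRows L cs len (pos ∘ there)) (unflag-flag c))
  (cong (λ es → es ++ L , c ∷ cs) (fromRow-item u v w (pos (here refl))))

toRows-bounded : ∀ {m b} (L : List (StreamItem n)) (cs : Vec Bool m) → (∀ {e} → e ∈ L → Valid b e) →
  VecAll.All (ℕ._< 2 ^ (b ℕ.+ bitLength n)) (toRows L cs)
toRows-bounded {n} {b = b} = go
  where
  grow : ∀ {k x} → k ℕ.≤ b ℕ.+ bitLength n → x ℕ.< 2 ^ k → x ℕ.< 2 ^ (b ℕ.+ bitLength n)
  grow k≤ x< = ℕ.<-≤-trans x< (ℕ.^-monoʳ-≤ 2 k≤)
  -- `bitLength n` is at least 1, so a word can hold a flag even when `b` is 0.
  one : 1 ℕ.< 2 ^ (b ℕ.+ bitLength n)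
  one = grow {1} (ℕ.≤-trans (ℕ.s≤s ℕ.z≤n) (ℕ.m≤n+m (bitLength n) b)) (ℕ.s≤s (ℕ.s≤s ℕ.z≤n))
  nil : 0 ℕ.< 2 ^ (b ℕ.+ bitLength n)
  nil = ℕ.<-trans (ℕ.s≤s ℕ.z≤n) one
  bool : ∀ c → flag c ℕ.< 2 ^ (b ℕ.+ bitLength n)
  bool true  = one
  bool false = nil
  vertex : ∀ (u : Fin n) → toℕ u ℕ.< 2 ^ (b ℕ.+ bitLength n)
  vertex u = grow (ℕ.m≤n+m (bitLength n) b) (ℕ.<-trans (toℕ<n u) (n<2^bitLength n))
  go : ∀ {m} (L : List (StreamItem n)) (cs : Vec Bool m) → (∀ {e} → e ∈ L → Valid b e) →
    VecAll.All (ℕ._< 2 ^ (b ℕ.+ bitLength n)) (toRows L cs)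
  go []                []       _     = []
  go (_ ∷ _)           []       _     = []
  go []                (c ∷ cs) valid = nil ∷ nil ∷ nil ∷ nil ∷ nil ∷ bool c ∷ go [] cs (λ ())
  go ((u , v , w) ∷ L) (c ∷ cs) valid with valid (here refl)
  ... | (num< , den<) , _ =
    one ∷ vertex u ∷ vertex v ∷ grow (ℕ.m≤m+n b _) num< ∷ grow (ℕ.m≤m+n b _) den< ∷ bool c ∷ go L cs (valid ∘ there)

map-fromBits-toBits : ∀ {k m} {xs : Vec ℕ m} → VecAll.All (ℕ._< 2 ^ k) xs →
  Vec.map fromBits (Vec.map (toBits k) xs) ≡ xs
map-fromBits-toBits         []         = refl
map-fromBits-toBits {k = k} (x< ∷ xs<) = cong₂ _∷_ (fromBits-toBits k x<) (map-fromBits-toBits xs<)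

module _ (n b : ℕ) where

  store : List (StreamItem n) → Vec Bool n → Memory n b (n ℕ.* 6)
  store T C = Vec.map (toBits _) (toRows T C)

  load : Memory n b (n ℕ.* 6) → List (StreamItem n) × Vec Bool n
  load M = fromRows n (Vec.map fromBits M)

  load-store : ∀ T C → length T ℕ.≤ n → (∀ {e} → e ∈ T → Valid b e) → load (store T C) ≡ (T , C)
  load-store T C len valid = trans (cong (fromRows n) (map-fromBits-toBits (toRows-bounded {b = b} T C valid)))
    (fromRows-toRows T C len (proj₂ ∘ valid))

-- The algorithm and its runs

algorithm : TwoPassAlgorithm
algorithm = record
  { space   = λ n b → n ℕ.* 6
  ; start   = λ n b → store n b [] (replicate n false)
  ; pass₁   = λ n b M e → let T , C = load n b M in store n b (update T e) C
  ; between = λ n b M → M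
  ; pass₂   = λ n b M e → let T , C = load n b M in store n b T (mark T C e)
  ; output  = λ n b M → let T , C = load n b M in estimate T (bit C)
  }

module _ {n b : ℕ} where

  -- A forest fits into the `n` slots, so memory decodes exactly and the invariant can speak of
  -- lists. The items seen are listed latest first, hence the reversed append.
  pass₁-run : ∀ s {seen T C} → (∀ {e} → e ∈ seen → Valid b e) → (∀ {e} → e ∈ s → Valid b e) → IsMSF seen T →
    ∃[ T′ ] foldl (pass₁ algorithm n b) (store n b T C) s ≡ store n b T′ C × IsMSF (s ʳ++ seen) T′
  pass₁-run []      {T = T} _  _ msf = T , refl , msf
  pass₁-run (e ∷ s) {seen} {T} {C} valid valid-s msf =
    let T′ , eq , msf′ = pass₁-run s {C = C} (λ { (here refl) → valid-s (here refl) ; (there f∈) → valid f∈ })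
                           (valid-s ∘ there) (update-IsMSF msf)
    in T′ , trans (cong (λ (T , C) → foldl (pass₁ algorithm n b) (store n b (update T e) C) s)
              (load-store n b T C (length-Forest forest) (valid ∘ subset))) eq , msf′
    where open IsMSF msf

  pass₂-run : ∀ {T} → length T ℕ.≤ n → (∀ {e} → e ∈ T → Valid b e) →
    ∀ s {seen C} → (∀ {e} → e ∈ s → Valid b e) → IsCover T seen (bit C) →
    ∃[ C′ ] foldl (pass₂ algorithm n b) (store n b T C) s ≡ store n b T C′ × IsCover T (s ʳ++ seen) (bit C′)
  pass₂-run {T} len valid []      {C = C} _ K = C , refl , K
  pass₂-run {T} len valid (e ∷ s) {C = C} valid-s K =
    let C′ , eq , K′ = pass₂-run len valid s (valid-s ∘ there)
                         (mark-IsCover {C = C} len (proj₂ ∘ valid) (proj₂ (valid-s (here refl))) K)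
    in C′ , trans (cong (λ (T , C) → foldl (pass₂ algorithm n b) (store n b T (mark T C e)) s)
              (load-store n b T C len valid)) eq , K′

IsMSF-reverse : ∀ {s T : List (StreamItem n)} → IsMSF (reverse s) T → IsMSF s T
IsMSF-reverse msf = record
  { descending = descending ; forest = forest ; subset = reverse⁻ ∘ subset ; light = light ∘ reverse⁺ }
  where open IsMSF msf

IsCover-reverse : ∀ {s T : List (StreamItem n)} {C} → IsCover T (reverse s) C → IsCover T s C
IsCover-reverse K = record
  { cover = cover ; subset = reverse⁻ ∘ subset ; covered = covered ; cheap = cheap
  ; exhaustive = exhaustive ∘ reverse⁺ }
  where open IsCover K

IsMSF-[] : IsMSF {n} [] []
IsMSF-[] = record { descending = [] ; forest = [] ; subset = λ () ; light = λ () }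

bit-replicate : ∀ m i → false ≡ bit (replicate m false) i
bit-replicate zero    i       = refl
bit-replicate (suc m) zero    = refl
bit-replicate (suc m) (suc i) = bit-replicate m i

algorithm-run : ∀ {n b} s → (∀ {e} → e ∈ s → Valid b e) →
  ∃[ T ] ∃[ C ] run algorithm n b s ≡ estimate T C × IsMSF s T × IsCover T s C
algorithm-run {n} {b} s valid =
  let T , eq₁ , msf-rev = pass₁-run {n} {b} s {C = replicate n false} (λ ()) valid IsMSF-[]
      msf = IsMSF-reverse msf-rev
      open IsMSF msf
      len = length-Forest forest
      C , eq₂ , K = pass₂-run {n} {b} len (valid ∘ subset) s valid
                      (IsCover-cong (λ i _ → bit-replicate n i) (IsCover-[] T))
  in T , bit C ,
     trans (cong (output algorithm n b) (trans (cong (λ M → foldl (pass₂ algorithm n b) M s) eq₁) eq₂))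
       (cong (λ (T , C) → estimate T (bit C)) (load-store n b T C len (valid ∘ subset))) ,
     msf , IsCover-reverse K

theorem1p6 : Σ[ A ∈ TwoPassAlgorithm ]
    UsesÕ[n]Space A ×
    (∀ (n b : ℕ) (G : WeightedGraph n) → Connected G → WeightsHaveBitSize b G →
    ∀ (s : List (StreamItem n)) → IsGraphStream G s →
    ∃[ t ] IsTSP G t × t ≤ run A n b s × run A n b s ≤ (+ 196 / 100) * t)
theorem1p6 = algorithm ,
  -- Six words for each of `n` slots; counted in words, the space has no logarithmic factor.
  (6 , 0 , λ n b → ℕ.≤-reflexive (trans (ℕ.*-comm n 6) (cong (6 ℕ.*_) (sym (ℕ.*-identityʳ n))))) ,
  λ { (suc m) b G conn small s stream →
    let open IsGraphStream stream
        d , isMetric = shortestPathMetric G conn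
        t , (c , c≡t) , least = shortestTour d
        T , C , run≡ , msf , K = algorithm-run {suc m} {b} s (λ e∈ → small _ _ _ (sound e∈) , stream-nonNeg stream e∈)
        open IsMSF msf
        c′ , c′≤ = upper-bound Fin.zero forest (spanning stream msf conn) subset K
                     (d-refl G isMetric) (d-sym G isMetric) (d-triangle G isMetric) (d-edge G isMetric ∘ sound)
    in t , (d , isMetric , (c , c≡t) , least) ,
       subst (t ≤_) (sym run≡) (ℚ.≤-trans (least c′) c′≤) ,
       subst₂ (λ x t → x ≤ (+ 196 / 100) * t) (sym run≡) c≡t (lower-bound stream msf K isMetric c Fin.zero)
    ; zero b G (nz , _) → contradiction refl (ℕ.≢-nonZero⁻¹ 0 {{nz}}) }
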